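{- Let $0<\epsilon<1$ and $C>0$ be constants. There exist constants $c>0$ and $n_0$ (depending only on $\epsilon$ and $C$) such that the following holds for all integers $n\ge n_0$, $2\le\Delta\le n-1$ and $4\le k\le C n^{1-\epsilon}$: if there is a deterministic algorithm in the CONGEST$(B)$ model using $\lfloor (k-1)/2\rfloor$ rounds that solves the $k$-cycle membership problem on all $n$-node graphs of maximum degree at most $\Delta$, then $$B \;\geq\; c\,\log\left(\left(\frac{n-2}{2(\Delta-1)}\right)^{\Delta-1}\right).$$
   Context: CONGEST$(B)$ model (with $KT_1$ knowledge): the network is a simple undirected graph on $n$ nodes, each node having a unique ID in $[N]=\{1,\dots,N\}$, where $N\ge n$ is some polynomial in $n$. Initially each node knows its own ID and the IDs of its neighbors (and the global parameters such as $n$, $\Delta$, $k$, $N$), and nothing else about the graph. Computation proceeds in synchronous rounds; in each round each node sends a message of exactly $B$ bits ($B\ge 1$) to each of its neighbors (possibly different messages to different neighbors). The message sent in a round is a function of the initial knowledge of the node and the messages received in previous rounds; local computation is unbounded. After the last round each node produces an output determined by its initial knowledge and all messages it received. An algorithm solves a problem on a class of graphs if it is correct for every graph in the class and every assignment of distinct IDs from $[N]$. $k$-cycle membership problem: each node must output whether it is contained in a (simple) cycle of length $k$ of the graph. (The number $\lfloor (k-1)/2\rfloor$ is the optimal round complexity of this problem with unlimited bandwidth.) Logarithms are base 2. -}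

module Defs where

open import Algebra.Definitions.RawSemiring using () renaming (_^_ to pow)
open import Data.Bool using (Bool; true)
open import Data.Fin using (Fin; toℕ; _≟_)
open import Data.Fin.Properties using (any?)
open import Data.Fin.Subset using (Subset; _∈_; _∉_; ∣_∣)
open import Data.Fin.Subset.Properties using (_∈?_)
open import Data.Integer using (+_)
import Data.Integer as ℤ
open import Data.Maybe using (Maybe)
import Data.Maybe as Maybe
open import Data.Nat using (ℕ; zero; suc; _≤_; s≤s)
import Data.Nat as ℕ
open import Data.Product using (∃; _×_; _,_)
open import Data.Rational using (ℚ; 0ℚ; 1ℚ; _/_; ↥_; ↧ₙ_)
import Data.Rational as ℚ
open import Data.Sum using (_⊎_)
open import Data.Vec using (Vec; []; _∷_; tabulate)
open import Function using (Injective; _⇔_)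
open import Relation.Binary.PropositionalEquality using (_≡_)
open import Relation.Nullary using (¬_; Dec; does; dec⇒maybe; _×-dec_)

------------------------------------------------------------------------
-- Real constants

-- Dedekind reals: `lower q` reads q < x, `upper q` reads x < q.
record ℝ : Set₁ where
  field
    lower upper     : ℚ → Set
    lower-inhabited : ∃ lower
    upper-inhabited : ∃ upper
    lower-rounded   : ∀ q → lower q ⇔ ∃ λ r → q ℚ.< r × lower r
    upper-rounded   : ∀ q → upper q ⇔ ∃ λ r → r ℚ.< q × upper r
    disjoint        : ∀ q → ¬ (lower q × upper q)
    located         : ∀ {q r} → q ℚ.< r → lower q ⊎ upper r

infix 4 _<ℝ_ _ℝ<_

_<ℝ_ : ℚ → ℝ → Set
q <ℝ x = ℝ.lower x q

_ℝ<_ : ℝ → ℚ → Set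
x ℝ< q = ℝ.upper x q

infixr 8 _^_

_^_ : ℚ → ℕ → ℚ
_^_ = pow ℚ.+-*-rawSemiring

fromℕ : ℕ → ℚ
fromℕ m = + m / 1

-- k ≤ D · n ^ f for rationals D, f ≥ 0; with f = a / b both sides are raised
-- to the power b.
RationalPowerBound : (k : ℕ) (D : ℚ) (n : ℕ) (f : ℚ) → Set
RationalPowerBound k D n f =
  fromℕ k ^ (↧ₙ f) ℚ.≤ (D ^ (↧ₙ f)) ℚ.* (fromℕ n ^ ℤ.∣ ↥ f ∣)

-- k ≤ C · n ^ (1 - ε) for reals C > 0 and 0 < ε < 1. For n ≥ 1 the right-hand
-- side is the infimum of D · n ^ (1 - e) over rational D > C and 0 < e < ε.
PowerBound : (k : ℕ) (C : ℝ) (n : ℕ) (ε : ℝ) → Set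
PowerBound k C n ε =
  ∀ e D → 0ℚ ℚ.< e → e <ℝ ε → C ℝ< D → RationalPowerBound k D n (1ℚ ℚ.- e)

infix 4 _·log₂_≤_

-- c · log₂ x ≤ B for rationals c ≥ 0 and x > 0: with c = a / b this says
-- x ^ a ≤ 2 ^ (B · b).
_·log₂_≤_ : ℚ → ℚ → ℕ → Set
c ·log₂ x ≤ B = x ^ ℤ.∣ ↥ c ∣ ℚ.≤ fromℕ 2 ^ (B ℕ.* ↧ₙ c)

-- ((n - 2) / (2 (Δ - 1))) ^ (Δ - 1); the hypothesis makes the denominator
-- nonzero.
logArgument : (n Δ : ℕ) → 2 ≤ Δ → ℚ
logArgument n (suc (suc d)) (s≤s (s≤s _)) =
  ((+ n ℤ.- + 2) / (2 ℕ.* suc d)) ^ suc d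

------------------------------------------------------------------------
-- Graphs

record Graph (n : ℕ) : Set where
  field
    neighbours  : Fin n → Subset n
    symmetric   : ∀ {u v} → u ∈ neighbours v → v ∈ neighbours u
    irreflexive : ∀ {v} → v ∉ neighbours v

  Adjacent : Fin n → Fin n → Set
  Adjacent u v = v ∈ neighbours u

  degree : Fin n → ℕ
  degree v = ∣ neighbours v ∣

open Graph public

MaxDegree≤ : ∀ {n} → Graph n → ℕ → Set
MaxDegree≤ G Δ = ∀ v → degree G v ≤ Δ

record IsCycle {n} (G : Graph n) (k : ℕ) (c : Fin k → Fin n) : Set where
  field
    3≤length : 3 ≤ k
    distinct : Injective _≡_ _≡_ c
    step     : ∀ i j → suc (toℕ i) ≡ toℕ j → Adjacent G (c i) (c j)
    close    : ∀ i j → suc (toℕ i) ≡ k → toℕ j ≡ 0 → Adjacent G (c i) (c j)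

OnCycle : ∀ {n} → Graph n → ℕ → Fin n → Set
OnCycle {n} G k v =
  ∃ λ (c : Fin k → Fin n) → IsCycle G k c × (∃ λ i → c i ≡ v)

------------------------------------------------------------------------
-- The CONGEST(B) model with KT₁ knowledge; `Fin N` is the ID space [N]

Message : ℕ → Set
Message B = Vec Bool B

-- A node's own ID and the set of its neighbours' IDs.
Knowledge : ℕ → Set
Knowledge N = Fin N × Subset N

-- The messages received in one round, indexed by the sender's ID; `nothing`
-- at IDs that are not IDs of neighbours.
Inbox : ℕ → ℕ → Set
Inbox N B = Vec (Maybe (Message B)) N

-- A deterministic algorithm running for T rounds. Histories list the latest
-- round first. `send κ h j` is the message sent to the neighbour with ID j
-- after length h completed rounds; its values at other IDs j, and at histories
-- of T or more rounds, are never used. Global parameters may be built into the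
-- algorithm.
record Algorithm (N B T : ℕ) : Set where
  field
    send   : ∀ {r} → Knowledge N → Vec (Inbox N B) r → Fin N → Message B
    output : Knowledge N → Vec (Inbox N B) T → Bool

module Execution {n N B T} (A : Algorithm N B T)
                 (G : Graph n) (id : Fin n → Fin N) where
  open Algorithm A

  neighbourWithID? : ∀ v j → Dec (∃ λ u → u ∈ neighbours G v × id u ≡ j)
  neighbourWithID? v j = any? λ u → u ∈? neighbours G v ×-dec id u ≟ j

  knowledge : Fin n → Knowledge N
  knowledge v = id v , tabulate λ j → does (neighbourWithID? v j)

  history : ∀ r → Fin n → Vec (Inbox N B) r
  history zero    v = []
  history (suc r) v = tabulate received ∷ history r v
    where
    received : Fin N → Maybe (Message B)
    received j = Maybe.map
      (λ (u , _) → send (knowledge u) (history r u) (id v))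
      (dec⇒maybe (neighbourWithID? v j))

  result : Fin n → Bool
  result v = output (knowledge v) (history T v)

SolvesCycleMembership : ∀ {N B T} (n Δ k : ℕ) → Algorithm N B T → Set
SolvesCycleMembership {N} n Δ k A =
  (G : Graph n) → MaxDegree≤ G Δ →
  (id : Fin n → Fin N) → Injective _≡_ _≡_ id →
  ∀ v → Execution.result A G id v ≡ true ⇔ OnCycle G k v

{-# OPTIONS --safe #-}
module Submission where

-- Let T = ⌊ (k - 1) / 2 ⌋ and take a path of k - 2 core nodes, with v at
-- distance T - 1 from its first end. Hang a node a on the first end and a node
-- x on the last one; an edge between a and x then closes a k-cycle through v.
-- No node at distance less than T from v knows the further neighbours of a and
-- of x, so in T rounds v learns about them nothing beyond the first message of
-- a and that of x, each of B bits. If there were two neighbour lists of a with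
-- the same message, only one of them containing x, and two neighbour lists of x
-- with the same message, only one of them containing a, then v could not tell a
-- k-cycle from none. Hence for every pair a, x one of the two messages always
-- reveals whether the edge is present. Counting pairs, some node reveals
-- membership of at least about half of the m = n - k + 2 candidates, so its
-- messages separate all lists of at most Δ - 1 of these, and there are too many
-- of them for small B.

open import Defs
open import Data.Bool using (Bool; true; false)
import Data.Bool.Properties as Bool
open import Data.Fin using
  (Fin; zero; suc; toℕ; fromℕ<; inject₁; inject≤; combine; funToFin; finToFun; _≟_; _↑ʳ_;
   splitAt; join)
  renaming (fromℕ to top)
open import Data.Fin.Properties using
  (any?; suc-injective; toℕ<n; toℕ-fromℕ; toℕ-fromℕ<; toℕ-inject₁; toℕ-injective; fromℕ<-toℕ;
   inject≤-injective; combine-injective; funToFin-finToFin; finToFun-funToFin; injective⇒≤;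
   splitAt-join; join-splitAt)
open import Data.Fin.Relation.Unary.Top using (view; ‵fromℕ; ‵inject₁)
open import Data.Fin.Subset using
  (Subset; inside; outside; _∈_; _∉_; _⊆_; _∪_; ⁅_⁆; ⊤; ∣_∣) renaming (⊥ to ∅)
open import Data.Fin.Subset.Properties using
  (_∈?_; anySubset?; x∈p∪q⁺; x∈p∪q⁻; x∈⁅x⁆; x∈⁅y⁆⇒x≡y; ∉⊥; ∣⁅x⁆∣≡1; ∣⊥∣≡0; ∣⊤∣≡n; p⊆q⇒∣p∣≤∣q∣)
open import Data.Integer using (-[1+_])
import Data.Integer as ℤ
import Data.Integer.Properties as ℤ
import Data.Maybe as Maybe
import Data.Maybe.Properties as Maybe
open import Data.Nat using (ℕ; zero; suc; _+_; _*_; _≤_; _<_; _∸_; ∣_-_∣; ⌊_/2⌋; z≤n; s≤s; NonZero)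
import Data.Nat as ℕ
import Data.Nat.DivMod as ℕ
import Data.Nat.Properties as ℕ
open import Data.Nat.Solver using (module +-*-Solver)
open import Data.Product using (Σ; ∃; ∃₂; ∃-syntax; _×_; _,_; proj₁; proj₂)
open import Data.Rational using (ℚ; 0ℚ; 1ℚ; ½; _/_; ↥_; ↧ₙ_; mkℚ)
import Data.Rational as ℚ
import Data.Rational.Properties as ℚ
open import Data.Rational.Unnormalised using (mkℚᵘ)
import Data.Rational.Unnormalised as ℚᵘ
import Data.Rational.Unnormalised.Properties as ℚᵘ
open import Data.Sum using (_⊎_; inj₁; inj₂; [_,_]′)
import Data.Sum as Sum
open import Data.Vec using (Vec; []; _∷_; _++_; lookup; tabulate; here; there)
open import Data.Vec.Properties using
  (lookup∘tabulate; tabulate-cong; []=⇒lookup; lookup⇒[]=; ≡-dec)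
open import Function using (Injective; _∘_; mk⇔; module Equivalence)
open import Relation.Binary.PropositionalEquality
open import Relation.Nullary using
  (¬_; Dec; yes; no; does; dec⇒maybe; contradiction; ¬?; _×-dec_; _⊎-dec_)
open import Relation.Nullary.Decidable using (does-⇔; dec-true; decidable-stable)
open import Relation.Unary using (Decidable)

open import Algebra.Properties.CommutativeMonoid.Sum ℕ.+-0-commutativeMonoid
  using (sum; sum-cong-≗; ∑-comm; ∑-distrib-+)
open import Algebra.Properties.CommutativeSemigroup ℕ.*-commutativeSemigroup using (interchange)
open +-*-Solver using (solve; con; _:+_; _:*_; _:=_)

-- Arithmetic

fromℕ-* : ∀ a b → fromℕ (a * b) ≡ fromℕ a ℚ.* fromℕ b
fromℕ-* a b = ℚ.toℚᵘ-injective (begin-equality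
  ℚ.toℚᵘ (fromℕ (a * b))                  ≃⟨ ℚ.toℚᵘ-fromℚᵘ (mkℚᵘ (ℤ.+ (a * b)) 0) ⟩
  mkℚᵘ (ℤ.+ (a * b)) 0                    ≡⟨ cong (λ i → mkℚᵘ i 0) (ℤ.pos-* a b) ⟩
  mkℚᵘ (ℤ.+ a) 0 ℚᵘ.* mkℚᵘ (ℤ.+ b) 0      ≃⟨ ℚᵘ.*-cong (ℚ.toℚᵘ-fromℚᵘ (mkℚᵘ (ℤ.+ a) 0)) (ℚ.toℚᵘ-fromℚᵘ (mkℚᵘ (ℤ.+ b) 0)) ⟨
  ℚ.toℚᵘ (fromℕ a) ℚᵘ.* ℚ.toℚᵘ (fromℕ b)  ≃⟨ ℚ.toℚᵘ-homo-* (fromℕ a) (fromℕ b) ⟨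
  ℚ.toℚᵘ (fromℕ a ℚ.* fromℕ b)            ∎)
  where open ℚᵘ.≤-Reasoning

fromℕ-^ : ∀ a b → fromℕ (a ℕ.^ b) ≡ fromℕ a ^ b
fromℕ-^ a zero    = refl
fromℕ-^ a (suc b) = trans (fromℕ-* a (a ℕ.^ b)) (cong (fromℕ a ℚ.*_) (fromℕ-^ a b))

/-≤-fromℕ : ∀ a d b .{{_ : NonZero d}} → a ≤ b * d → ℤ.+ a / d ℚ.≤ fromℕ b
/-≤-fromℕ a (suc d) b a≤bd = ℚ.toℚᵘ-cancel-≤ (begin
  ℚ.toℚᵘ (ℤ.+ a / suc d)  ≃⟨ ℚ.toℚᵘ-fromℚᵘ (mkℚᵘ (ℤ.+ a) d) ⟩
  mkℚᵘ (ℤ.+ a) d          ≤⟨ ℚᵘ.*≤* (subst₂ ℤ._≤_ (ℤ.pos-* a 1) (ℤ.pos-* b (suc d))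
                             (ℤ.+≤+ (ℕ.≤-trans (ℕ.≤-reflexive (ℕ.*-identityʳ a)) a≤bd))) ⟩
  mkℚᵘ (ℤ.+ b) 0          ≃⟨ ℚ.toℚᵘ-fromℚᵘ (mkℚᵘ (ℤ.+ b) 0) ⟨
  ℚ.toℚᵘ (fromℕ b)        ∎)
  where open ℚᵘ.≤-Reasoning

fromℕ-mono-≤ : ∀ {a b} → a ≤ b → fromℕ a ℚ.≤ fromℕ b
fromℕ-mono-≤ {a} {b} a≤b = /-≤-fromℕ a 1 b (ℕ.≤-trans a≤b (ℕ.≤-reflexive (sym (ℕ.*-identityʳ b))))

fromℕ-cancel-≤ : ∀ {a b} → fromℕ a ℚ.≤ fromℕ b → a ≤ b
fromℕ-cancel-≤ {a} {b} le = ℤ.drop‿+≤+ (subst₂ ℤ._≤_ (ℤ.*-identityʳ (ℤ.+ a)) (ℤ.*-identityʳ (ℤ.+ b))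
  (ℚᵘ.drop-*≤* (begin
    mkℚᵘ (ℤ.+ a) 0    ≃⟨ ℚ.toℚᵘ-fromℚᵘ (mkℚᵘ (ℤ.+ a) 0) ⟨
    ℚ.toℚᵘ (fromℕ a)  ≤⟨ ℚ.toℚᵘ-mono-≤ le ⟩
    ℚ.toℚᵘ (fromℕ b)  ≃⟨ ℚ.toℚᵘ-fromℚᵘ (mkℚᵘ (ℤ.+ b) 0) ⟩
    mkℚᵘ (ℤ.+ b) 0    ∎)))
  where open ℚᵘ.≤-Reasoning

^-nonNeg : ∀ p d → ℚ.NonNegative p → ℚ.NonNegative (p ^ d)
^-nonNeg p zero    _  = _
^-nonNeg p (suc d) p≥0 = ℚ.nonNeg*nonNeg⇒nonNeg p {{p≥0}} (p ^ d) {{^-nonNeg p d p≥0}}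

^-monoˡ-≤ : ∀ {p q} d → ℚ.NonNegative p → p ℚ.≤ q → p ^ d ℚ.≤ q ^ d
^-monoˡ-≤         zero    _   _   = ℚ.≤-refl
^-monoˡ-≤ {p} {q} (suc d) p≥0 p≤q = begin
  p ℚ.* p ^ d  ≤⟨ ℚ.*-monoʳ-≤-nonNeg (p ^ d) {{^-nonNeg p d p≥0}} p≤q ⟩
  q ℚ.* p ^ d  ≤⟨ ℚ.*-monoˡ-≤-nonNeg q {{q≥0}} (^-monoˡ-≤ d p≥0 p≤q) ⟩
  q ℚ.* q ^ d  ∎
  where
  open ℚ.≤-Reasoning
  q≥0 = ℚ.nonNegative (ℚ.≤-trans (ℚ.nonNegative⁻¹ p {{p≥0}}) p≤q)

-- For c = ½ the claim is x ≤ 2 ^ (B · 2) with x = `logArgument`, so an integer `b` above its base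
-- (n - 2) / (2 (Δ - 1)) suffices; here Δ = 2 + `d`. From 2 ≤ n the integer difference n - 2 is a
-- natural number.
½·log₂-≤ : ∀ n d B b → n ∸ 2 ≤ b * (2 * suc d) → b ℕ.^ suc d ≤ 2 ℕ.^ (B * 2) → 2 ≤ n →
           ½ ·log₂ logArgument n (2 + d) (s≤s (s≤s z≤n)) ≤ B
½·log₂-≤ (suc zero) _ _ _ _ _ (s≤s ())
½·log₂-≤ (suc (suc n)) d B b n≤ b^d≤ _ = begin
  (x ^ suc d) ℚ.* 1ℚ     ≡⟨ ℚ.*-identityʳ (x ^ suc d) ⟩
  x ^ suc d              ≤⟨ ^-monoˡ-≤ (suc d) (ℚ.normalize-nonNeg n (2 * suc d)) (/-≤-fromℕ n (2 * suc d) b n≤) ⟩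
  fromℕ b ^ suc d        ≡⟨ fromℕ-^ b (suc d) ⟨
  fromℕ (b ℕ.^ suc d)    ≤⟨ fromℕ-mono-≤ b^d≤ ⟩
  fromℕ (2 ℕ.^ (B * 2))  ≡⟨ fromℕ-^ 2 (B * 2) ⟩
  fromℕ 2 ^ (B * 2)      ∎
  where
  open ℚ.≤-Reasoning
  x = ℤ.+ n / (2 * suc d)

-- Real constants and sublinear bounds

upper-closed : ∀ (x : ℝ) {p q} → p ℚ.≤ q → x ℝ< p → x ℝ< q
upper-closed x {p} {q} p≤q x<p with p ℚ.<? q
... | yes p<q = Equivalence.from (ℝ.upper-rounded x q) (p , p<q , x<p)
... | no  p≮q = subst (x ℝ<_) (ℚ.≤-antisym p≤q (ℚ.≮⇒≥ p≮q)) x<p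

<ℝ-ℝ<⇒< : ∀ (x : ℝ) {p q} → p <ℝ x → x ℝ< q → p ℚ.< q
<ℝ-ℝ<⇒< x {p} {q} p<x x<q with p ℚ.<? q
... | yes p<q = p<q
... | no  p≮q = contradiction (p<x , upper-closed x (ℚ.≮⇒≥ p≮q) x<q) (ℝ.disjoint x p)

≤-fromℕ : ∀ (p : ℚ) → ∃[ D ] p ℚ.≤ fromℕ D
≤-fromℕ (mkℚ i d c) = ℤ.∣ i ∣ , subst (ℚ._≤ _) (ℚ.↥p/↧p≡p (mkℚ i d c)) (go i)
  where
  go : ∀ i → i / suc d ℚ.≤ fromℕ ℤ.∣ i ∣
  go (ℤ.+ a)    = /-≤-fromℕ a (suc d) a (ℕ.m≤m*n a (suc d))
  go -[1+ a ] = ℚ.≤-trans (ℚ.<⇒≤ (ℚ.negative⁻¹ (-[1+ a ] / suc d) {{ℚ.neg-pos {ℚ.normalize (suc a) (suc d)} (ℚ.normalize-pos (suc a) (suc d))}}))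
                          (fromℕ-mono-≤ {0} {suc a} z≤n)

proper-fraction : ∀ f → 0ℚ ℚ.< f → f ℚ.< 1ℚ → ∃[ b ] ↧ₙ f ≡ suc b × ℤ.∣ ↥ f ∣ ≤ b
proper-fraction (mkℚ (ℤ.+ a) b _) _ (ℚ.*<* lt) = b , refl ,
  ℕ.s≤s⁻¹ (ℤ.drop‿+<+ (subst₂ ℤ._<_ (ℤ.*-identityʳ (ℤ.+ a)) (ℤ.*-identityˡ (ℤ.+ suc b)) lt))
proper-fraction (mkℚ -[1+ _ ] _ _) (ℚ.*<* ()) _

^-distribʳ-* : ∀ c a b → (a * b) ℕ.^ c ≡ a ℕ.^ c * b ℕ.^ c
^-distribʳ-* zero    a b = refl
^-distribʳ-* (suc c) a b = trans (cong (a * b *_) (^-distribʳ-* c a b)) (interchange a b (a ℕ.^ c) (b ℕ.^ c))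

-- If 2 k > n, then n ^ (b + 1) ≤ (2 D) ^ (b + 1) · n ^ a, and a ≤ b permits cancelling n ^ b, which
-- leaves n ≤ (2 D) ^ (b + 1).
root-bound : ∀ D k n a b → a ≤ b → (2 * D) ℕ.^ suc b < n →
             k ℕ.^ suc b ≤ D ℕ.^ suc b * n ℕ.^ a → 2 * k ≤ n
root-bound D k n@(suc _) a b a≤b n-large k≤ with 2 * k ℕ.≤? n
... | yes 2k≤n = 2k≤n
... | no  2k≰n = contradiction (ℕ.*-cancelʳ-≤ n ((2 * D) ℕ.^ suc b) (n ℕ.^ b) {{ℕ.m^n≢0 n b}} (begin
  n ℕ.^ suc b                            ≤⟨ ℕ.^-monoˡ-≤ (suc b) (ℕ.<⇒≤ (ℕ.≰⇒> 2k≰n)) ⟩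
  (2 * k) ℕ.^ suc b                      ≡⟨ ^-distribʳ-* (suc b) 2 k ⟩
  2 ℕ.^ suc b * k ℕ.^ suc b              ≤⟨ ℕ.*-monoʳ-≤ (2 ℕ.^ suc b) k≤ ⟩
  2 ℕ.^ suc b * (D ℕ.^ suc b * n ℕ.^ a)  ≡⟨ ℕ.*-assoc (2 ℕ.^ suc b) _ _ ⟨
  2 ℕ.^ suc b * D ℕ.^ suc b * n ℕ.^ a    ≡⟨ cong (ℕ._* n ℕ.^ a) (^-distribʳ-* (suc b) 2 D) ⟨
  (2 * D) ℕ.^ suc b * n ℕ.^ a            ≤⟨ ℕ.*-monoʳ-≤ ((2 * D) ℕ.^ suc b) (ℕ.^-monoʳ-≤ n a≤b) ⟩
  (2 * D) ℕ.^ suc b * n ℕ.^ b            ∎)) (ℕ.<⇒≱ n-large)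
  where open ℕ.≤-Reasoning

RationalPowerBound⇒≤ : ∀ k D n f → RationalPowerBound k (fromℕ D) n f →
                       k ℕ.^ ↧ₙ f ≤ D ℕ.^ ↧ₙ f * n ℕ.^ ℤ.∣ ↥ f ∣
RationalPowerBound⇒≤ k D n f bound = fromℕ-cancel-≤ {k ℕ.^ b} {D ℕ.^ b * n ℕ.^ a} (begin
  fromℕ (k ℕ.^ b)                      ≡⟨ fromℕ-^ k b ⟩
  fromℕ k ^ b                          ≤⟨ bound ⟩
  fromℕ D ^ b ℚ.* fromℕ n ^ a          ≡⟨ cong₂ ℚ._*_ (fromℕ-^ D b) (fromℕ-^ n a) ⟨
  fromℕ (D ℕ.^ b) ℚ.* fromℕ (n ℕ.^ a)  ≡⟨ fromℕ-* (D ℕ.^ b) (n ℕ.^ a) ⟨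
  fromℕ (D ℕ.^ b * n ℕ.^ a)            ∎)
  where
  open ℚ.≤-Reasoning
  a = ℤ.∣ ↥ f ∣
  b = ↧ₙ f

-- The bound is taken at one rational e strictly between 0 and ε and one natural number D above C.
-- The exponent 1 - e lies strictly between 0 and 1, so k is sublinear in n.
PowerBound⇒2k≤n : (ε C : ℝ) → 0ℚ <ℝ ε → ε ℝ< 1ℚ →
                  ∃[ n₀ ] ∀ k n → n₀ ≤ n → PowerBound k C n ε → 2 * k ≤ n
PowerBound⇒2k≤n ε C 0<ε ε<1
  with e , 0<e , e<ε ← Equivalence.to (ℝ.lower-rounded ε 0ℚ) 0<ε
     | q , C<q ← ℝ.upper-inhabited C
  with D , q≤D ← ≤-fromℕ q
  with b , ↧≡ , ↥≤ ← proper-fraction (1ℚ ℚ.- e)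
         (subst (ℚ._< 1ℚ ℚ.- e) (ℚ.+-inverseʳ e) (ℚ.+-monoˡ-< (ℚ.- e) (<ℝ-ℝ<⇒< ε e<ε ε<1)))
         (subst (1ℚ ℚ.- e ℚ.<_) (ℚ.+-identityʳ 1ℚ) (ℚ.+-monoʳ-< 1ℚ (ℚ.neg-antimono-< 0<e)))
  = suc ((2 * D) ℕ.^ suc b) , λ k n n₀≤n bound →
    root-bound D k n _ b ↥≤ n₀≤n
      (subst (λ b′ → k ℕ.^ b′ ≤ D ℕ.^ b′ * n ℕ.^ ℤ.∣ ↥ (1ℚ ℚ.- e) ∣) ↧≡
        (RationalPowerBound⇒≤ k D n (1ℚ ℚ.- e) (bound e (fromℕ D) 0<e e<ε (upper-closed C q≤D C<q))))

-- For d ≤ M take q = M / d: then n / (2 d) ≤ 2 M / d < 2 (1 + q) ≤ (1 + q) ^ 2.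
-- For larger d, n / (2 d) is at most 2 and singleton blocks suffice.
block-arithmetic : ∀ n M d B .{{_ : NonZero d}} → n ≤ 4 * M →
                   (∀ {d′ q} → d′ ≤ d → d′ * q ≤ M → suc q ℕ.^ d′ ≤ 2 ℕ.^ B) →
                   ∃[ b ] n ≤ b * (2 * d) × b ℕ.^ d ≤ 2 ℕ.^ (B * 2)
block-arithmetic n M d B n≤4M blocks with d ℕ.≤? M | 2 * M ℕ.≤? d
... | yes d≤M | _ = b * b , n≤ , b^d≤
  where
  open ℕ.≤-Reasoning
  q = M ℕ./ d
  b = suc q

  2≤b : 2 ≤ b
  2≤b = s≤s (ℕ.m≥n⇒m/n>0 d≤M)

  n≤ : n ≤ b * b * (2 * d)
  n≤ = begin
    n                  ≤⟨ n≤4M ⟩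
    4 * M              ≤⟨ ℕ.*-monoʳ-≤ 4 (ℕ.<⇒≤ (begin-strict
      M                ≡⟨ ℕ.m≡m%n+[m/n]*n M d ⟩
      M ℕ.% d + q * d  <⟨ ℕ.+-monoˡ-< (q * d) (ℕ.m%n<n M d) ⟩
      b * d            ∎)) ⟩
    4 * (b * d)        ≡⟨ ℕ.*-assoc 2 2 (b * d) ⟩
    2 * (2 * (b * d))  ≤⟨ ℕ.*-monoˡ-≤ (2 * (b * d)) 2≤b ⟩
    b * (2 * (b * d))  ≡⟨ cong (b *_) (ℕ.*-assoc 2 b d) ⟨
    b * (2 * b * d)    ≡⟨ cong (λ t → b * (t * d)) (ℕ.*-comm 2 b) ⟩
    b * (b * 2 * d)    ≡⟨ cong (b *_) (ℕ.*-assoc b 2 d) ⟩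
    b * (b * (2 * d))  ≡⟨ ℕ.*-assoc b b (2 * d) ⟨
    b * b * (2 * d)    ∎

  b^d≤ : (b * b) ℕ.^ d ≤ 2 ℕ.^ (B * 2)
  b^d≤ = begin
    (b * b) ℕ.^ d    ≡⟨ cong (λ t → (b * t) ℕ.^ d) (ℕ.*-identityʳ b) ⟨
    (b ℕ.^ 2) ℕ.^ d  ≡⟨ ℕ.^-*-assoc b 2 d ⟩
    b ℕ.^ (2 * d)    ≡⟨ cong (b ℕ.^_) (ℕ.*-comm 2 d) ⟩
    b ℕ.^ (d * 2)    ≡⟨ ℕ.^-*-assoc b d 2 ⟨
    (b ℕ.^ d) ℕ.^ 2  ≤⟨ ℕ.^-monoˡ-≤ 2 (blocks ℕ.≤-refl (ℕ.≤-trans (ℕ.≤-reflexive (ℕ.*-comm d q)) (ℕ.m/n*n≤m M d))) ⟩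
    (2 ℕ.^ B) ℕ.^ 2  ≡⟨ ℕ.^-*-assoc 2 B 2 ⟩
    2 ℕ.^ (B * 2)    ∎
-- Here n ≤ 4 M ≤ 2 d, so b = 1 already works.
... | no d≰M | yes 2M≤d = 1 , n≤ , ℕ.≤-trans (ℕ.≤-reflexive (ℕ.^-zeroˡ d)) (ℕ.m^n>0 2 (B * 2))
  where
  open ℕ.≤-Reasoning
  n≤ : n ≤ 1 * (2 * d)
  n≤ = begin
    n            ≤⟨ n≤4M ⟩
    4 * M        ≡⟨ ℕ.*-assoc 2 2 M ⟩
    2 * (2 * M)  ≤⟨ ℕ.*-monoʳ-≤ 2 2M≤d ⟩
    2 * d        ≡⟨ ℕ.*-identityˡ (2 * d) ⟨
    1 * (2 * d)  ∎
-- M singleton blocks, `d′` = M and `q` = 1, give 2 ^ M ≤ 2 ^ B; since d < 2 M, squaring bounds 2 ^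
-- d.
... | no d≰M | no 2M≰d = 2 , n≤ , 2^d≤
  where
  open ℕ.≤-Reasoning
  M≤d = ℕ.<⇒≤ (ℕ.≰⇒> d≰M)

  n≤ : n ≤ 2 * (2 * d)
  n≤ = begin
    n            ≤⟨ n≤4M ⟩
    4 * M        ≡⟨ ℕ.*-assoc 2 2 M ⟩
    2 * (2 * M)  ≤⟨ ℕ.*-monoʳ-≤ 2 (ℕ.*-monoʳ-≤ 2 M≤d) ⟩
    2 * (2 * d)  ∎

  2^d≤ : 2 ℕ.^ d ≤ 2 ℕ.^ (B * 2)
  2^d≤ = begin
    2 ℕ.^ d          ≤⟨ ℕ.^-monoʳ-≤ 2 (ℕ.<⇒≤ (ℕ.≰⇒> 2M≰d)) ⟩
    2 ℕ.^ (2 * M)    ≡⟨ cong (2 ℕ.^_) (ℕ.*-comm 2 M) ⟩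
    2 ℕ.^ (M * 2)    ≡⟨ ℕ.^-*-assoc 2 M 2 ⟨
    (2 ℕ.^ M) ℕ.^ 2  ≤⟨ ℕ.^-monoˡ-≤ 2 (blocks M≤d (ℕ.≤-reflexive (ℕ.*-identityʳ M))) ⟩
    (2 ℕ.^ B) ℕ.^ 2  ≡⟨ ℕ.^-*-assoc 2 B 2 ⟩
    2 ℕ.^ (B * 2)    ∎

⌈n/2⌉≤1+⌊n/2⌋ : ∀ n → ℕ.⌈ n /2⌉ ≤ suc ⌊ n /2⌋
⌈n/2⌉≤1+⌊n/2⌋ zero          = z≤n
⌈n/2⌉≤1+⌊n/2⌋ (suc zero)    = ℕ.≤-refl
⌈n/2⌉≤1+⌊n/2⌋ (suc (suc n)) = s≤s (⌈n/2⌉≤1+⌊n/2⌋ n)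

5+ℓ≤m : ∀ ℓ m → 2 * (3 + ℓ) ≤ suc ℓ + m → 5 + ℓ ≤ m
5+ℓ≤m ℓ m 2k≤n = ℕ.+-cancelˡ-≤ (suc ℓ) (5 + ℓ) m (begin
  suc ℓ + (5 + ℓ)  ≡⟨ solve 1 (λ l → con 1 :+ l :+ (con 5 :+ l) := con 2 :* (con 3 :+ l)) refl ℓ ⟩
  2 * (3 + ℓ)      ≤⟨ 2k≤n ⟩
  suc ℓ + m        ∎)
  where open ℕ.≤-Reasoning

-- The universe exceeds the core by at least 4, so n + 4 ≤ 2 m ≤ 2 + 4 ⌊m/2⌋; the slack absorbs the
-- rounding.
n≤4⌊m/2⌋ : ∀ ℓ m → 5 + ℓ ≤ m → suc ℓ + m ≤ 4 * ⌊ m /2⌋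
n≤4⌊m/2⌋ ℓ m 5+ℓ≤m = ℕ.+-cancelˡ-≤ 4 (suc ℓ + m) (4 * M) (begin
  5 + ℓ + m                    ≤⟨ ℕ.+-mono-≤ (ℕ.≤-trans 5+ℓ≤m m≤1+2M) m≤1+2M ⟩
  1 + (M + M) + (1 + (M + M))  ≡⟨ solve 1 (λ t → con 1 :+ (t :+ t) :+ (con 1 :+ (t :+ t)) := con 2 :+ con 4 :* t) refl M ⟩
  2 + 4 * M                    ≤⟨ ℕ.m≤n+m (2 + 4 * M) 2 ⟩
  4 + 4 * M                    ∎)
  where
  open ℕ.≤-Reasoning
  M = ⌊ m /2⌋

  m≤1+2M : m ≤ 1 + (M + M)
  m≤1+2M = begin
    m              ≡⟨ ℕ.⌊n/2⌋+⌈n/2⌉≡n m ⟨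
    M + ℕ.⌈ m /2⌉  ≤⟨ ℕ.+-monoʳ-≤ M (⌈n/2⌉≤1+⌊n/2⌋ m) ⟩
    M + suc M      ≡⟨ ℕ.+-suc M M ⟩
    1 + (M + M)    ∎

-- Subsets of finite sets

∣p∪q∣≤∣p∣+∣q∣ : ∀ {n} (p q : Subset n) → ∣ p ∪ q ∣ ≤ ∣ p ∣ + ∣ q ∣
∣p∪q∣≤∣p∣+∣q∣ []            []            = z≤n
∣p∪q∣≤∣p∣+∣q∣ (outside ∷ p) (outside ∷ q) = ∣p∪q∣≤∣p∣+∣q∣ p q
∣p∪q∣≤∣p∣+∣q∣ (outside ∷ p) (inside  ∷ q) =
  ℕ.≤-trans (s≤s (∣p∪q∣≤∣p∣+∣q∣ p q)) (ℕ.≤-reflexive (sym (ℕ.+-suc ∣ p ∣ ∣ q ∣)))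
∣p∪q∣≤∣p∣+∣q∣ (inside  ∷ p) (outside ∷ q) = s≤s (∣p∪q∣≤∣p∣+∣q∣ p q)
∣p∪q∣≤∣p∣+∣q∣ (inside  ∷ p) (inside  ∷ q) =
  s≤s (ℕ.≤-trans (∣p∪q∣≤∣p∣+∣q∣ p q) (ℕ.+-monoʳ-≤ ∣ p ∣ (ℕ.n≤1+n ∣ q ∣)))

enumerate : ∀ {n} (p : Subset n) →
            ∃[ e ] Injective {A = Fin ∣ p ∣} {B = Fin n} _≡_ _≡_ e × (∀ i → e i ∈ p)
enumerate []            = (λ ()) , (λ { {()} }) , λ ()
enumerate (outside ∷ p) with e , e-inj , e∈p ← enumerate p =
  suc ∘ e , e-inj ∘ suc-injective , there ∘ e∈p
enumerate (inside ∷ p) with e , e-inj , e∈p ← enumerate p =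
  (λ { zero → zero ; (suc i) → suc (e i) }) ,
  (λ { {zero} {zero} _ → refl ; {suc _} {suc _} eq → cong suc (e-inj (suc-injective eq)) }) ,
  (λ { zero → here ; (suc i) → there (e∈p i) })

sum-mono-≤ : ∀ {n} {f g : Fin n → ℕ} → (∀ i → f i ≤ g i) → sum f ≤ sum g
sum-mono-≤ {zero}  f≤g = z≤n
sum-mono-≤ {suc n} f≤g = ℕ.+-mono-≤ (f≤g zero) (sum-mono-≤ (f≤g ∘ suc))

sum-const : ∀ n c → sum {n} (λ _ → c) ≡ n * c
sum-const zero    c = refl
sum-const (suc n) c = cong (c +_) (sum-const n c)

indicator : Bool → ℕ
indicator inside  = 1
indicator outside = 0

∣p∣≡sum : ∀ {n} (p : Subset n) → ∣ p ∣ ≡ sum (indicator ∘ lookup p)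
∣p∣≡sum []            = refl
∣p∣≡sum (inside  ∷ p) = cong suc (∣p∣≡sum p)
∣p∣≡sum (outside ∷ p) = ∣p∣≡sum p

transpose : ∀ {m n} → (Fin m → Subset n) → Fin n → Subset m
transpose Q x = tabulate λ y → lookup (Q y) x

∈-transpose : ∀ {m n} (Q : Fin m → Subset n) {x y} → x ∈ Q y → y ∈ transpose Q x
∈-transpose Q {x} {y} x∈Qy = lookup⇒[]= y (transpose Q x)
  (trans (lookup∘tabulate (λ z → lookup (Q z) x) y) ([]=⇒lookup x∈Qy))

-- Both sides count the pairs x, y with x ∈ `Q y`.
sum-transpose : ∀ {m n} (Q : Fin m → Subset n) → sum (∣_∣ ∘ transpose Q) ≡ sum (∣_∣ ∘ Q)
sum-transpose Q = begin
  sum (∣_∣ ∘ transpose Q)                                       ≡⟨ sum-cong-≗ (∣p∣≡sum ∘ transpose Q) ⟩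
  sum (λ x → sum (λ y → indicator (lookup (transpose Q x) y)))  ≡⟨ sum-cong-≗ (λ x → sum-cong-≗ (λ y →
                                                                    cong indicator (lookup∘tabulate (λ z → lookup (Q z) x) y))) ⟩
  sum (λ x → sum (λ y → indicator (lookup (Q y) x)))            ≡⟨ ∑-comm (λ x y → indicator (lookup (Q y) x)) ⟩
  sum (λ y → sum (λ x → indicator (lookup (Q y) x)))            ≡⟨ sum-cong-≗ (∣p∣≡sum ∘ Q) ⟨
  sum (∣_∣ ∘ Q)                                                 ∎
  where open ≡-Reasoning

-- Double counting: of the m (m - 1) ordered pairs, each lies in a row of P or
-- in a column of Q, so one of these 2 m sets has at least (m - 1) / 2 elements.
large-row : ∀ {m} (P Q : Fin m → Subset m) .{{_ : NonZero m}} →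
            (∀ {x y} → x ≢ y → y ∈ P x ⊎ x ∈ Q y) →
            (∃[ x ] ⌊ m /2⌋ ≤ ∣ P x ∣) ⊎ (∃[ y ] ⌊ m /2⌋ ≤ ∣ Q y ∣)
large-row {m@(suc _)} P Q cover
  with any? (λ x → ⌊ m /2⌋ ℕ.≤? ∣ P x ∣) | any? (λ y → ⌊ m /2⌋ ℕ.≤? ∣ Q y ∣)
... | yes large | _         = inj₁ large
... | no _      | yes large = inj₂ large
... | no ¬P     | no ¬Q     = contradiction (ℕ.*-cancelˡ-≤ m (ℕ.≤-trans total upper)) (ℕ.<⇒≱ lower)
  where
  -- If every set has fewer than ⌊m/2⌋ elements, hence at most `h`, then counting gives m · m ≤ m (1
  -- + 2 h), although 1 + 2 h < m. The 1 accounts for the diagonal pairs.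
  h = ℕ.pred ⌊ m /2⌋

  P≤h : ∀ x → ∣ P x ∣ ≤ h
  P≤h x = ℕ.suc[m]≤n⇒m≤pred[n] (ℕ.≰⇒> (¬P ∘ (x ,_)))

  Q≤h : ∀ y → ∣ Q y ∣ ≤ h
  Q≤h y = ℕ.suc[m]≤n⇒m≤pred[n] (ℕ.≰⇒> (¬Q ∘ (y ,_)))

  h<⌊m/2⌋ : h < ⌊ m /2⌋
  -- Here ⌊m/2⌋ is positive because it exceeds the size of `P zero`.
  h<⌊m/2⌋ = ℕ.≤-reflexive (ℕ.suc-pred ⌊ m /2⌋ {{ℕ.>-nonZero (ℕ.≤-<-trans z≤n (ℕ.≰⇒> (¬P ∘ (zero ,_))))}})

  lower : 1 + (h + h) < m
  lower = begin-strict
    1 + (h + h)          <⟨ s≤s (ℕ.≤-reflexive (sym (ℕ.+-suc h h))) ⟩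
    suc h + suc h        ≤⟨ ℕ.+-mono-≤ h<⌊m/2⌋ h<⌊m/2⌋ ⟩
    ⌊ m /2⌋ + ⌊ m /2⌋    ≤⟨ ℕ.+-monoʳ-≤ ⌊ m /2⌋ (ℕ.⌊n/2⌋≤⌈n/2⌉ m) ⟩
    ⌊ m /2⌋ + ℕ.⌈ m /2⌉  ≡⟨ ℕ.⌊n/2⌋+⌈n/2⌉≡n m ⟩
    m                    ∎
    where open ℕ.≤-Reasoning

  row : ∀ x → m ≤ 1 + (∣ P x ∣ + ∣ transpose Q x ∣)
  row x = begin
    m                                    ≡⟨ ∣⊤∣≡n m ⟨
    ∣ ⊤ {m} ∣                            ≤⟨ p⊆q⇒∣p∣≤∣q∣ {p = ⊤} (λ {y} _ → all y) ⟩
    ∣ ⁅ x ⁆ ∪ (P x ∪ transpose Q x) ∣    ≤⟨ ∣p∪q∣≤∣p∣+∣q∣ ⁅ x ⁆ _ ⟩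
    ∣ ⁅ x ⁆ ∣ + ∣ P x ∪ transpose Q x ∣  ≤⟨ ℕ.+-mono-≤ (ℕ.≤-reflexive (∣⁅x⁆∣≡1 x)) (∣p∪q∣≤∣p∣+∣q∣ (P x) _) ⟩
    1 + (∣ P x ∣ + ∣ transpose Q x ∣)    ∎
    where
    open ℕ.≤-Reasoning
    all : ∀ y → y ∈ ⁅ x ⁆ ∪ (P x ∪ transpose Q x)
    all y with x ≟ y
    ... | yes refl = x∈p∪q⁺ (inj₁ (x∈⁅x⁆ x))
    ... | no  x≢y  = x∈p∪q⁺ (inj₂ (x∈p∪q⁺ (Sum.map₂ (∈-transpose Q) (cover x≢y))))

  total : m * m ≤ m * 1 + (sum (∣_∣ ∘ P) + sum (∣_∣ ∘ Q))
  total = begin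
    m * m                                                        ≡⟨ sum-const m m ⟨
    sum {m} (λ _ → m)                                            ≤⟨ sum-mono-≤ row ⟩
    sum (λ x → 1 + (∣ P x ∣ + ∣ transpose Q x ∣))                ≡⟨ ∑-distrib-+ {m} (λ _ → 1) (λ x → ∣ P x ∣ + ∣ transpose Q x ∣) ⟩
    sum {m} (λ _ → 1) + sum (λ x → ∣ P x ∣ + ∣ transpose Q x ∣)  ≡⟨ cong₂ _+_ (sum-const m 1) (∑-distrib-+ (∣_∣ ∘ P) (∣_∣ ∘ transpose Q)) ⟩
    m * 1 + (sum (∣_∣ ∘ P) + sum (∣_∣ ∘ transpose Q))            ≡⟨ cong (λ s → m * 1 + (sum (∣_∣ ∘ P) + s)) (sum-transpose Q) ⟩
    m * 1 + (sum (∣_∣ ∘ P) + sum (∣_∣ ∘ Q))                      ∎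
    where open ℕ.≤-Reasoning

  upper : m * 1 + (sum (∣_∣ ∘ P) + sum (∣_∣ ∘ Q)) ≤ m * (1 + (h + h))
  upper = begin
    m * 1 + (sum (∣_∣ ∘ P) + sum (∣_∣ ∘ Q))          ≤⟨ ℕ.+-monoʳ-≤ (m * 1) (ℕ.+-mono-≤ (sum-mono-≤ P≤h) (sum-mono-≤ Q≤h)) ⟩
    m * 1 + (sum {m} (λ _ → h) + sum {m} (λ _ → h))  ≡⟨ cong (m * 1 +_) (cong₂ _+_ (sum-const m h) (sum-const m h)) ⟩
    m * 1 + (m * h + m * h)                          ≡⟨ cong (m * 1 +_) (ℕ.*-distribˡ-+ m h h) ⟨
    m * 1 + m * (h + h)                              ≡⟨ ℕ.*-distribˡ-+ m 1 (h + h) ⟨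
    m * (1 + (h + h))                                ∎
    where open ℕ.≤-Reasoning

-- Counting sets by distinct codes

pick : ∀ {q m} → (Fin q → Fin m) → Fin (suc q) → Subset m
pick e zero    = ∅
pick e (suc j) = ⁅ e j ⁆

-- Block i consists of the elements `e i j`. The value `zero` of `f i` takes nothing from it, so a
-- block of q elements offers 1 + q options.
choose : ∀ {d q m} → (Fin d → Fin q → Fin m) → (Fin d → Fin (suc q)) → Subset m
choose {zero}  e f = ∅
choose {suc d} e f = pick (e zero) (f zero) ∪ choose (e ∘ suc) (f ∘ suc)

∣pick∣≤1 : ∀ {q m} (e : Fin q → Fin m) i → ∣ pick e i ∣ ≤ 1
∣pick∣≤1 {m = m} e zero    = ℕ.≤-trans (ℕ.≤-reflexive (∣⊥∣≡0 m)) z≤n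
∣pick∣≤1         e (suc j) = ℕ.≤-reflexive (∣⁅x⁆∣≡1 (e j))

∣choose∣≤ : ∀ {d q m} (e : Fin d → Fin q → Fin m) f → ∣ choose e f ∣ ≤ d
∣choose∣≤ {zero}  {m = m} e f = ℕ.≤-reflexive (∣⊥∣≡0 m)
∣choose∣≤ {suc d} e f = ℕ.≤-trans (∣p∪q∣≤∣p∣+∣q∣ (pick (e zero) (f zero)) _)
  (ℕ.+-mono-≤ (∣pick∣≤1 (e zero) (f zero)) (∣choose∣≤ (e ∘ suc) (f ∘ suc)))

∈-choose⁺ : ∀ {d q m} (e : Fin d → Fin q → Fin m) f i {j} → f i ≡ suc j → e i j ∈ choose e f
∈-choose⁺ e f zero {j} eq = x∈p∪q⁺ (inj₁ (subst (λ c → e zero j ∈ pick (e zero) c) (sym eq) (x∈⁅x⁆ (e zero j))))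
∈-choose⁺ e f (suc i)  eq = x∈p∪q⁺ {p = pick (e zero) (f zero)} (inj₂ (∈-choose⁺ (e ∘ suc) (f ∘ suc) i eq))

∈-choose⁻ : ∀ {d q m} (e : Fin d → Fin q → Fin m) f {y} → y ∈ choose e f →
            ∃₂ λ i j → f i ≡ suc j × y ≡ e i j
∈-choose⁻ {zero}  e f y∈ = contradiction y∈ ∉⊥
∈-choose⁻ {suc d} e f {y} y∈ with x∈p∪q⁻ (pick (e zero) (f zero)) _ y∈
... | inj₂ y∈tail with i , j , eq , y≡ ← ∈-choose⁻ (e ∘ suc) (f ∘ suc) y∈tail = suc i , j , eq , y≡
... | inj₁ y∈pick = go (f zero) refl y∈pick
  where
  go : ∀ c → f zero ≡ c → y ∈ pick (e zero) c → ∃₂ λ i j → f i ≡ suc j × y ≡ e i j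
  go zero    _  y∈∅ = contradiction y∈∅ ∉⊥
  go (suc j) eq y∈  = zero , j , eq , x∈⁅y⁆⇒x≡y (e zero j) y∈

bit : Bool → Fin 2
bit false = zero
bit true  = suc zero

bit-injective : Injective _≡_ _≡_ bit
bit-injective {false} {false} _ = refl
bit-injective {true}  {true}  _ = refl

encode : ∀ {B} → Vec Bool B → Fin (2 ℕ.^ B)
encode v = funToFin (bit ∘ lookup v)

funToFin-injective : ∀ {m n} {f g : Fin m → Fin n} → funToFin f ≡ funToFin g → f ≗ g
funToFin-injective {f = f} {g} eq i = begin
  f i                      ≡⟨ finToFun-funToFin f i ⟨
  finToFun (funToFin f) i  ≡⟨ cong (λ x → finToFun x i) eq ⟩
  finToFun (funToFin g) i  ≡⟨ finToFun-funToFin g i ⟩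
  g i                      ∎
  where open ≡-Reasoning

funToFin-cong : ∀ {m n} {f g : Fin m → Fin n} → f ≗ g → funToFin f ≡ funToFin g
funToFin-cong {zero}  f≗g = refl
funToFin-cong {suc m} f≗g = cong₂ combine (f≗g zero) (funToFin-cong (f≗g ∘ suc))

finToFun-injective : ∀ {m n} {x y : Fin (n ℕ.^ m)} → finToFun {n} {m} x ≗ finToFun y → x ≡ y
finToFun-injective {m} {n} {x} {y} eq = begin
  x                              ≡⟨ funToFin-finToFin {m} {n} x ⟨
  funToFin (finToFun {n} {m} x)  ≡⟨ funToFin-cong eq ⟩
  funToFin (finToFun {n} {m} y)  ≡⟨ funToFin-finToFin {m} {n} y ⟩
  y                              ∎
  where open ≡-Reasoning

encode-injective : ∀ {B} → Injective _≡_ _≡_ (encode {B})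
encode-injective {B} {v} {w} eq = lookup-ext v w (bit-injective ∘ funToFin-injective eq)
  where
  lookup-ext : ∀ {B} (v w : Vec Bool B) → lookup v ≗ lookup w → v ≡ w
  lookup-ext []      []      _  = refl
  lookup-ext (x ∷ v) (y ∷ w) eq = cong₂ _∷_ (eq zero) (lookup-ext v w (eq ∘ suc))

-- Exchanging `S` and `S′` shows that this is injectivity of `g` on the subsets of `D` with at most
-- `d` elements, spelled out elementwise, which is how the absence of collisions yields it.
Determines : ∀ {m B} → (Subset m → Vec Bool B) → ℕ → Subset m → Set
Determines g d D = ∀ {y S S′} → ∣ S ∣ ≤ d → ∣ S′ ∣ ≤ d → S ⊆ D → S′ ⊆ D →
                   y ∈ D → g S ≡ g S′ → y ∈ S → y ∈ S′

-- Inside D, form d′ blocks of q elements; choosing at most one element of each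
-- block yields suc q ^ d′ sets with distinct codes.
blocks≤2^B : ∀ {m B d} (g : Subset m → Vec Bool B) {D} → Determines g d D →
             ∀ {d′ q} → d′ ≤ d → d′ * q ≤ ∣ D ∣ → suc q ℕ.^ d′ ≤ 2 ℕ.^ B
blocks≤2^B {m} {B} {d} g {D} det {d′} {q} d′≤d d′q≤∣D∣ with e , e-inj , e∈D ← enumerate D =
  injective⇒≤ {f = code} λ {x} {y} eq → finToFun-injective {d′} {suc q}
    λ i → agree (finToFun {suc q} {d′} x) (finToFun y) (encode-injective eq) i
  where
  block : Fin d′ → Fin q → Fin m
  block i j = e (inject≤ (combine i j) d′q≤∣D∣)

  code : Fin (suc q ℕ.^ d′) → Fin (2 ℕ.^ B)
  code x = encode (g (choose block (finToFun {suc q} {d′} x)))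

  size : ∀ f → ∣ choose block f ∣ ≤ d
  size f = ℕ.≤-trans (∣choose∣≤ block f) d′≤d

  choose⊆D : ∀ f → choose block f ⊆ D
  choose⊆D f y∈ with _ , _ , _ , refl ← ∈-choose⁻ block f y∈ = e∈D _

  -- The blocks are disjoint, so a chosen element identifies its block and its index therein.
  transfer : ∀ f f′ → g (choose block f) ≡ g (choose block f′) → ∀ i {j} → f i ≡ suc j → f′ i ≡ suc j
  transfer f f′ eq i {j} fi≡
    with i′ , j′ , f′i′≡ , e≡ ← ∈-choose⁻ block f′
           (det (size f) (size f′) (choose⊆D f) (choose⊆D f′) (e∈D _) eq (∈-choose⁺ block f i fi≡))
    with refl , refl ← combine-injective i j i′ j′ (inject≤-injective _ _ _ _ (e-inj e≡))
    = f′i′≡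

  agree : ∀ f f′ → g (choose block f) ≡ g (choose block f′) → f ≗ f′
  agree f f′ eq i = go (f i) (f′ i) refl refl
    where
    go : ∀ c c′ → f i ≡ c → f′ i ≡ c′ → c ≡ c′
    go zero    zero    _  _   = refl
    go (suc j) c′      fi f′i = trans (sym (transfer f f′ eq i fi)) f′i
    go zero    (suc j) fi f′i = trans (sym fi) (transfer f′ f (sym eq) i f′i)

∈-tabulate⁺ : ∀ {n} {P : Fin n → Set} (P? : Decidable P) {u} → P u → u ∈ tabulate (does ∘ P?)
∈-tabulate⁺ P? {u} Pu = lookup⇒[]= u _ (trans (lookup∘tabulate (does ∘ P?) u) (dec-true (P? u) Pu))

∈-tabulate⁻ : ∀ {n} {P : Fin n → Set} (P? : Decidable P) {u} → u ∈ tabulate (does ∘ P?) → P u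
∈-tabulate⁻ P? {u} u∈ with P? u | trans (sym (lookup∘tabulate (does ∘ P?) u)) ([]=⇒lookup u∈)
... | yes Pu | _  = Pu
... | no  _  | ()

∣∅++p∣≡∣p∣ : ∀ k {n} (p : Subset n) → ∣ ∅ {k} ++ p ∣ ≡ ∣ p ∣
∣∅++p∣≡∣p∣ zero    p = refl
∣∅++p∣≡∣p∣ (suc k) p = ∣∅++p∣≡∣p∣ k p

↑ʳ-∈-++ : ∀ k {n} {p : Subset n} {y} → y ∈ p → k ↑ʳ y ∈ ∅ {k} ++ p
↑ʳ-∈-++ zero    y∈p = y∈p
↑ʳ-∈-++ (suc k) y∈p = there (↑ʳ-∈-++ k y∈p)

∣pair∣≤2 : ∀ {n} (p : Subset n) (y z : Fin n) → (∀ {u} → u ∈ p → u ≡ y ⊎ u ≡ z) → ∣ p ∣ ≤ 2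
∣pair∣≤2 p y z cover = begin
  ∣ p ∣                  ≤⟨ p⊆q⇒∣p∣≤∣q∣ (λ u∈p → [ (λ { refl → x∈p∪q⁺ (inj₁ (x∈⁅x⁆ y)) }) , (λ { refl → x∈p∪q⁺ (inj₂ (x∈⁅x⁆ z)) }) ]′ (cover u∈p)) ⟩
  ∣ ⁅ y ⁆ ∪ ⁅ z ⁆ ∣      ≤⟨ ∣p∪q∣≤∣p∣+∣q∣ ⁅ y ⁆ ⁅ z ⁆ ⟩
  ∣ ⁅ y ⁆ ∣ + ∣ ⁅ z ⁆ ∣  ≡⟨ cong₂ _+_ (∣⁅x⁆∣≡1 y) (∣⁅x⁆∣≡1 z) ⟩
  2                      ∎
  where open ℕ.≤-Reasoning

-- Executions and cycles

module Indistinguishability {n N B T} (A : Algorithm N B T) (id : Fin n → Fin N) where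
  open Algorithm A
  
  knowledge : Graph n → Fin n → Knowledge N
  knowledge G = Execution.knowledge A G id

  history : Graph n → ∀ r → Fin n → Vec (Inbox N B) r
  history G = Execution.history A G id

  result : Graph n → Fin n → Bool
  result G = Execution.result A G id

  -- Taking the neighbour set as an argument lets `cong` transport equal neighbour sets; at
  -- `neighbours G v` these definitions unfold to those of `Execution`.
  sender? : ∀ s j → Dec (∃ λ u → u ∈ s × id u ≡ j)
  sender? s j = any? λ u → u ∈? s ×-dec id u ≟ j

  knowledgeOf : Fin n → Subset n → Knowledge N
  knowledgeOf v s = id v , tabulate λ j → does (sender? s j)

  receive : Subset n → (Fin n → Message B) → Inbox N B
  receive s f = tabulate λ j →
    Maybe.map (λ (u , _) → f u) (dec⇒maybe (sender? s j))

  receive-cong : ∀ s {f g} → (∀ {u} → u ∈ s → f u ≡ g u) → receive s f ≡ receive s g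
  receive-cong s f≗g = tabulate-cong λ j → Maybe.map-cong (λ (u , u∈s , _) → f≗g u∈s) (dec⇒maybe (sender? s j))

  -- Information travels one level per round, so of the nodes on level T only
  -- the very first messages can influence a node on level 0.
  module _ (G G′ : Graph n) (level : Fin n → ℕ)
           (same  : ∀ {u} → level u < T → neighbours G u ≡ neighbours G′ u)
           (close : ∀ {u w} → level u < T → w ∈ neighbours G u → level w ≤ suc (level u))
           (first : ∀ {u w} → level u < T → w ∈ neighbours G u →
                    send (knowledge G w) [] (id u) ≡ send (knowledge G′ w) [] (id u))
           where

    history-agree : ∀ r {u} → r + level u ≤ T → history G r u ≡ history G′ r u
    history-agree zero    _  = refl
    history-agree (suc r) {u} r+u<T = cong₂ _∷_
      (trans (receive-cong (neighbours G u) (message r r+u<T))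
             (cong (λ s → receive s λ w → send (knowledge G′ w) (history G′ r w) (id u)) (same u<T)))
      (history-agree r (ℕ.<⇒≤ r+u<T))
      where
      u<T : level u < T
      u<T = ℕ.≤-trans (s≤s (ℕ.m≤n+m (level u) r)) r+u<T

      message : ∀ r → suc r + level u ≤ T → ∀ {w} → w ∈ neighbours G u →
                send (knowledge G w) (history G r w) (id u) ≡
                send (knowledge G′ w) (history G′ r w) (id u)
      -- In the first round the sender may lie on level T, where the neighbour sets may differ. In
      -- later rounds it lies below level T and induction applies.
      message zero    _      w∈ = first u<T w∈
      message (suc r) r+u<T {w} w∈ = cong₂ (λ κ h → send κ h (id u))
        (cong (knowledgeOf w) (same (ℕ.≤-trans (s≤s (ℕ.m≤n+m (level w) r)) r+w≤T)))
        (history-agree (suc r) r+w≤T)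
        where
        r+w≤T : suc r + level w ≤ T
        r+w≤T = ℕ.≤-trans (ℕ.+-monoʳ-≤ (suc r) (close u<T w∈))
                          (ℕ.≤-trans (ℕ.≤-reflexive (ℕ.+-suc (suc r) (level u))) r+u<T)

    result-agree : ∀ {v} → level v ≡ 0 → 0 < T → result G v ≡ result G′ v
    result-agree {v} v≡0 0<T = cong₂ output
      (cong (knowledgeOf v) (same (subst (_< T) (sym v≡0) 0<T)))
      (history-agree T (ℕ.≤-reflexive (trans (cong (T +_) v≡0) (ℕ.+-identityʳ T))))

-- The two positions are the cyclic successor and predecessor, distinct since the length is at least
-- 3. `view` singles out the last position, whose successor wraps around.
cycle-neighbours : ∀ {n ℓ} {G : Graph n} {c : Fin (3 + ℓ) → Fin n} → IsCycle G (3 + ℓ) c →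
                   ∀ i → ∃₂ λ p q → p ≢ q × Adjacent G (c i) (c p) × Adjacent G (c i) (c q)
cycle-neighbours {ℓ = ℓ} {G} cyc zero =
  suc zero , top (2 + ℓ) , (λ ()) ,
  IsCycle.step cyc zero (suc zero) refl ,
  symmetric G (IsCycle.close cyc (top (2 + ℓ)) zero (cong suc (toℕ-fromℕ (2 + ℓ))) refl)
cycle-neighbours {ℓ = ℓ} {G} cyc (suc i) with view i
... | ‵fromℕ = zero , inject₁ (top (1 + ℓ)) , (λ ()) ,
  IsCycle.close cyc (suc (top (1 + ℓ))) zero (cong (2 +_) (toℕ-fromℕ (1 + ℓ))) refl ,
  symmetric G (IsCycle.step cyc _ _ (cong suc (toℕ-inject₁ (top (1 + ℓ)))))
... | ‵inject₁ j = suc (suc j) , inject₁ (inject₁ j) , p≢q ,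
  IsCycle.step cyc (suc (inject₁ j)) (suc (suc j)) (cong (2 +_) (toℕ-inject₁ j)) ,
  symmetric G (IsCycle.step cyc (inject₁ (inject₁ j)) (suc (inject₁ j)) (cong suc (toℕ-inject₁ (inject₁ j))))
  where
  p≢q : suc (suc j) ≢ inject₁ (inject₁ j)
  p≢q eq = ℕ.<⇒≢ (ℕ.m<n+m (toℕ j) {2} (s≤s z≤n))
    (sym (trans (cong toℕ eq) (trans (toℕ-inject₁ (inject₁ j)) (toℕ-inject₁ j))))

-- From one inner position the property descends to 0 and then climbs to 1 + L; consecutive pairs
-- are carried because each step starts from the later member. It propagates a cycle along the core.
spread : ∀ (P : ℕ → Set) L → (∀ j → j < L → P (suc j) → P j × P (2 + j)) →
         ∀ j₀ → j₀ < L → P (suc j₀) → ∀ j → j ≤ L → P j × P (suc j)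
spread P L step = λ j₀ j₀<L p → up (down j₀ j₀<L p)
  where
  down : ∀ j → j < L → P (suc j) → P 0 × P 1
  down zero    j<L p = proj₁ (step 0 j<L p) , p
  down (suc j) j<L p = down j (ℕ.<⇒≤ j<L) (proj₁ (step (suc j) j<L p))

  up : P 0 × P 1 → ∀ j → j ≤ L → P j × P (suc j)
  up p zero    _   = p
  up p (suc j) j<L with _ , q ← up p j (ℕ.<⇒≤ j<L) = q , proj₂ (step j j<L q)

-- The lower bound graphs

module Gadgets (ℓ m : ℕ) where

  -- The core is a path of 1 + ℓ nodes; the other m nodes form the universe.
  Place : Set
  Place = Fin (suc ℓ) ⊎ Fin m

  Node : Set
  Node = Fin (suc ℓ + m)

  place : Node → Place
  place = splitAt (suc ℓ)

  node : Place → Node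
  node = join (suc ℓ) m

  place-node : ∀ p → place (node p) ≡ p
  place-node = splitAt-join (suc ℓ) m

  node-place : ∀ {u p} → place u ≡ p → u ≡ node p
  node-place {u} refl = sym (join-splitAt (suc ℓ) m u)

  place-injective : ∀ {u w} → place u ≡ place w → u ≡ w
  place-injective eq = trans (node-place eq) (sym (node-place refl))

  -- The neighbourhood of a universe node hanging on core node `t` with further neighbours `S`,
  -- described without the rest of the gadget so that a first message depends on nothing else.
  Near : Fin (suc ℓ) → Subset m → Place → Set
  Near t S (inj₁ i) = i ≡ t
  Near t S (inj₂ y) = y ∈ S

  near? : ∀ t S → Decidable (Near t S)
  near? t S (inj₁ i) = i ≟ t
  near? t S (inj₂ y) = y ∈? S

  star : Fin (suc ℓ) → Subset m → Subset (suc ℓ + m)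
  star t S = tabulate (does ∘ near? t S ∘ place)

  ∣star∣≤ : ∀ t S → ∣ star t S ∣ ≤ suc ∣ S ∣
  ∣star∣≤ t S = begin
    ∣ star t S ∣                                ≤⟨ p⊆q⇒∣p∣≤∣q∣ (λ {u} u∈ → cover u (∈-tabulate⁻ (near? t S ∘ place) u∈)) ⟩
    ∣ ⁅ node (inj₁ t) ⁆ ∪ (∅ {suc ℓ} ++ S) ∣    ≤⟨ ∣p∪q∣≤∣p∣+∣q∣ ⁅ node (inj₁ t) ⁆ _ ⟩
    ∣ ⁅ node (inj₁ t) ⁆ ∣ + ∣ ∅ {suc ℓ} ++ S ∣  ≡⟨ cong₂ _+_ (∣⁅x⁆∣≡1 (node (inj₁ t))) (∣∅++p∣≡∣p∣ (suc ℓ) S) ⟩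
    suc ∣ S ∣                                   ∎
    where
    open ℕ.≤-Reasoning
    cover : ∀ u → Near t S (place u) → u ∈ ⁅ node (inj₁ t) ⁆ ∪ (∅ {suc ℓ} ++ S)
    cover u near with place u in eq
    cover u refl | inj₁ i = x∈p∪q⁺ (inj₁ (subst (_∈ ⁅ node (inj₁ t) ⁆) (sym (node-place eq)) (x∈⁅x⁆ _)))
    cover u y∈S  | inj₂ y = x∈p∪q⁺ {p = ⁅ node (inj₁ t) ⁆}
      (inj₂ (subst (_∈ ∅ {suc ℓ} ++ S) (sym (node-place eq)) (↑ʳ-∈-++ (suc ℓ) y∈S)))

  -- Universe nodes a and x hang on the two ends of the core and have the
  -- further neighbours S and R, so that an edge between a and x closes a cycle
  -- of length 3 + ℓ.
  record Gadget (a x : Fin m) : Set where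
    field
      S R     : Subset m
      a≢x     : a ≢ x
      a∉S     : a ∉ S
      x∉R     : x ∉ R
      x∈S⇒a∈R : x ∈ S → a ∈ R
      a∈R⇒x∈S : a ∈ R → x ∈ S

  module _ {a x : Fin m} where

    Attached : Fin (suc ℓ) → Fin m → Set
    Attached i y = (i ≡ zero × y ≡ a) ⊎ (i ≡ top ℓ × y ≡ x)

    attached? : ∀ i y → Dec (Attached i y)
    attached? i y = (i ≟ zero ×-dec y ≟ a) ⊎-dec (i ≟ top ℓ ×-dec y ≟ x)

    module _ (g : Gadget a x) where
      open Gadget g

      Leaf : Fin m → Fin m → Set
      Leaf y z = (y ≡ a × z ∈ S) ⊎ (y ≡ x × z ∈ R)

      leaf? : ∀ y z → Dec (Leaf y z)
      leaf? y z = (y ≟ a ×-dec z ∈? S) ⊎-dec (y ≟ x ×-dec z ∈? R)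

      Edge : Place → Place → Set
      Edge (inj₁ i) (inj₁ j) = suc (toℕ i) ≡ toℕ j ⊎ suc (toℕ j) ≡ toℕ i
      Edge (inj₁ i) (inj₂ y) = Attached i y
      Edge (inj₂ y) (inj₁ i) = Attached i y
      Edge (inj₂ y) (inj₂ z) = Leaf y z ⊎ Leaf z y

      edge? : ∀ p q → Dec (Edge p q)
      edge? (inj₁ i) (inj₁ j) = suc (toℕ i) ℕ.≟ toℕ j ⊎-dec suc (toℕ j) ℕ.≟ toℕ i
      edge? (inj₁ i) (inj₂ y) = attached? i y
      edge? (inj₂ y) (inj₁ i) = attached? i y
      edge? (inj₂ y) (inj₂ z) = leaf? y z ⊎-dec leaf? z y

      edge-sym : ∀ p q → Edge p q → Edge q p
      edge-sym (inj₁ i) (inj₁ j) = Sum.swap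
      edge-sym (inj₁ i) (inj₂ y) = λ e → e
      edge-sym (inj₂ y) (inj₁ i) = λ e → e
      edge-sym (inj₂ y) (inj₂ z) = Sum.swap

      leaf-irrefl : ∀ y → ¬ Leaf y y
      leaf-irrefl y (inj₁ (refl , a∈S)) = a∉S a∈S
      leaf-irrefl y (inj₂ (refl , x∈R)) = x∉R x∈R

      edge-irrefl : ∀ p → ¬ Edge p p
      edge-irrefl (inj₁ i) (inj₁ eq) = ℕ.1+n≢n eq
      edge-irrefl (inj₁ i) (inj₂ eq) = ℕ.1+n≢n eq
      edge-irrefl (inj₂ y) (inj₁ lf) = leaf-irrefl y lf
      edge-irrefl (inj₂ y) (inj₂ lf) = leaf-irrefl y lf

      row : Place → Subset (suc ℓ + m)
      row p = tabulate (does ∘ edge? p ∘ place)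

      network : Graph (suc ℓ + m)
      network = record
        { neighbours  = row ∘ place
        ; symmetric   = λ {u} {v} u∈ → ∈-tabulate⁺ (edge? (place u) ∘ place)
                          (edge-sym (place v) (place u) (∈-tabulate⁻ (edge? (place v) ∘ place) u∈))
        ; irreflexive = λ {v} v∈ → edge-irrefl (place v) (∈-tabulate⁻ (edge? (place v) ∘ place) v∈)
        }

      adjacent⁺ : ∀ {u w} → Edge (place u) (place w) → Adjacent network u w
      adjacent⁺ {u} = ∈-tabulate⁺ (edge? (place u) ∘ place)

      adjacent⁻ : ∀ {u w} → Adjacent network u w → Edge (place u) (place w)
      adjacent⁻ {u} = ∈-tabulate⁻ (edge? (place u) ∘ place)

      edge-a⁻ : ∀ p → Edge (inj₂ a) p → Near zero S p
      edge-a⁻ (inj₁ i) (inj₁ (i≡0 , _))           = i≡0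
      edge-a⁻ (inj₁ i) (inj₂ (_ , a≡x))           = contradiction a≡x a≢x
      edge-a⁻ (inj₂ z) (inj₁ (inj₁ (_ , z∈S)))    = z∈S
      edge-a⁻ (inj₂ z) (inj₁ (inj₂ (a≡x , _)))    = contradiction a≡x a≢x
      edge-a⁻ (inj₂ z) (inj₂ (inj₁ (_ , a∈S)))    = contradiction a∈S a∉S
      edge-a⁻ (inj₂ z) (inj₂ (inj₂ (refl , a∈R))) = a∈R⇒x∈S a∈R

      edge-a⁺ : ∀ p → Near zero S p → Edge (inj₂ a) p
      edge-a⁺ (inj₁ i) i≡0 = inj₁ (i≡0 , refl)
      edge-a⁺ (inj₂ z) z∈S = inj₁ (inj₁ (refl , z∈S))

      edge-x⁻ : ∀ p → Edge (inj₂ x) p → Near (top ℓ) R p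
      edge-x⁻ (inj₁ i) (inj₁ (_ , x≡a))           = contradiction (sym x≡a) a≢x
      edge-x⁻ (inj₁ i) (inj₂ (i≡ℓ , _))           = i≡ℓ
      edge-x⁻ (inj₂ z) (inj₁ (inj₁ (x≡a , _)))    = contradiction (sym x≡a) a≢x
      edge-x⁻ (inj₂ z) (inj₁ (inj₂ (_ , z∈R)))    = z∈R
      edge-x⁻ (inj₂ z) (inj₂ (inj₁ (refl , x∈S))) = x∈S⇒a∈R x∈S
      edge-x⁻ (inj₂ z) (inj₂ (inj₂ (_ , x∈R)))    = contradiction x∈R x∉R

      edge-x⁺ : ∀ p → Near (top ℓ) R p → Edge (inj₂ x) p
      edge-x⁺ (inj₁ i) i≡ℓ = inj₂ (i≡ℓ , refl)
      edge-x⁺ (inj₂ z) z∈R = inj₁ (inj₂ (refl , z∈R))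

      -- Leaves drawn from the side of x add nothing, as x ∈ `S` and a ∈ `R` are equivalent. Hence
      -- the first message of a depends on the gadget through `S` alone.
      row-a : row (inj₂ a) ≡ star zero S
      row-a = tabulate-cong λ u → does-⇔ (mk⇔ (edge-a⁻ (place u)) (edge-a⁺ (place u))) (edge? (inj₂ a) (place u)) (near? zero S (place u))

      row-x : row (inj₂ x) ≡ star (top ℓ) R
      row-x = tabulate-cong λ u → does-⇔ (mk⇔ (edge-x⁻ (place u)) (edge-x⁺ (place u))) (edge? (inj₂ x) (place u)) (near? (top ℓ) R (place u))

    -- The path a, core, x.
    at : ℕ → Place
    at zero    = inj₂ a
    at (suc j) with j ℕ.<? suc ℓ
    ... | yes j<1+ℓ = inj₁ (fromℕ< j<1+ℓ)
    ... | no  _     = inj₂ x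

    at-core : ∀ i → at (suc (toℕ i)) ≡ inj₁ i
    at-core i with toℕ i ℕ.<? suc ℓ
    ... | yes i<1+ℓ = cong inj₁ (fromℕ<-toℕ i i<1+ℓ)
    ... | no  i≮1+ℓ = contradiction (toℕ<n i) i≮1+ℓ

    at-end : at (2 + ℓ) ≡ inj₂ x
    at-end with suc ℓ ℕ.<? suc ℓ
    ... | yes ℓ<ℓ = contradiction ℓ<ℓ (ℕ.<-irrefl refl)
    ... | no  _   = refl

    at-inner : ∀ {j} → j < suc ℓ → ∃[ i ] toℕ i ≡ j × at (suc j) ≡ inj₁ i
    at-inner {j} j<1+ℓ = i , i≡j , subst (λ j → at (suc j) ≡ inj₁ i) i≡j (at-core i)
      where
      i   = fromℕ< j<1+ℓ
      i≡j = toℕ-fromℕ< j<1+ℓ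

    -- `position` is a left inverse of `at` up to 2 + ℓ; a ≢ x keeps the two ends apart.
    at-injective : a ≢ x → ∀ {j j′} → j ≤ 2 + ℓ → j′ ≤ 2 + ℓ → at j ≡ at j′ → j ≡ j′
    at-injective a≢x {j} {j′} j≤ j′≤ eq = trans (sym (position-at j j≤)) (trans (cong position eq) (position-at j′ j′≤))
      where
      position : Place → ℕ
      position (inj₁ i) = suc (toℕ i)
      position (inj₂ y) with y ≟ a
      ... | yes _ = 0
      ... | no  _ = 2 + ℓ

      position-at : ∀ j → j ≤ 2 + ℓ → position (at j) ≡ j
      position-at zero    _ with a ≟ a
      ... | yes _  = refl
      ... | no a≢a = contradiction refl a≢a
      position-at (suc j) (s≤s j≤) with j ℕ.<? suc ℓ
      ... | yes j<1+ℓ = cong suc (toℕ-fromℕ< j<1+ℓ)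
      ... | no  j≮1+ℓ with x ≟ a
      ...   | yes x≡a = contradiction (sym x≡a) a≢x
      ...   | no  _   = cong suc (ℕ.≤-antisym (ℕ.≮⇒≥ j≮1+ℓ) j≤)

    at-universe : ∀ {y} → y ≢ a → y ≢ x → ∀ j → at j ≢ inj₂ y
    at-universe y≢a y≢x zero    refl = y≢a refl
    at-universe y≢a y≢x (suc j) eq with j ℕ.<? suc ℓ
    at-universe y≢a y≢x (suc j) () | yes _
    at-universe y≢a y≢x (suc j) refl | no _ = y≢x refl

    module _ (g : Gadget a x) where
      open Gadget g

      -- Since a occupies position 0 of the path, core node i sits at position 1 + i.
      edge-core⁻ : ∀ i p → Edge g (inj₁ i) p → p ≡ at (toℕ i) ⊎ p ≡ at (2 + toℕ i)
      edge-core⁻ i (inj₁ j) (inj₁ 1+i≡j) = inj₂ (sym (trans (cong (at ∘ suc) 1+i≡j) (at-core j)))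
      edge-core⁻ i (inj₁ j) (inj₂ 1+j≡i) = inj₁ (sym (trans (cong at (sym 1+j≡i)) (at-core j)))
      edge-core⁻ i (inj₂ y) (inj₁ (refl , refl)) = inj₁ refl
      edge-core⁻ i (inj₂ y) (inj₂ (refl , refl)) =
        inj₂ (sym (trans (cong (at ∘ (2 +_)) (toℕ-fromℕ ℓ)) at-end))

      at-edge : ∀ j → j ≤ suc ℓ → Edge g (at j) (at (suc j))
      at-edge zero    _         = inj₁ (refl , refl)
      at-edge (suc j) (s≤s j≤ℓ) with i , refl , at≡ ← at-inner (s≤s j≤ℓ) | view i
      ... | ‵fromℕ = subst₂ (Edge g) (sym at≡)
        (sym (trans (cong (at ∘ (2 +_)) (toℕ-fromℕ ℓ)) at-end)) (inj₂ (refl , refl))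
      ... | ‵inject₁ i′ = subst₂ (Edge g) (sym at≡)
        (sym (trans (cong (at ∘ (2 +_)) (toℕ-inject₁ i′)) (at-core (suc i′)))) (inj₁ (cong suc (toℕ-inject₁ i′)))

      -- The nodes a and x have one core neighbour and at most Δ - 1 further ones, with Δ = 2 + `d`;
      -- every other node has at most two neighbours.
      degree≤ : ∀ {d} → ∣ S ∣ ≤ suc d → ∣ R ∣ ≤ suc d → MaxDegree≤ (network g) (2 + d)
      degree≤ {d} ∣S∣≤ ∣R∣≤ u = row-size (place u)
        where
        only : ∀ {y} → y ≢ a → y ≢ x → ∀ p → Edge g (inj₂ y) p → p ≡ inj₂ a ⊎ p ≡ inj₂ x
        only y≢a y≢x (inj₁ i) (inj₁ (_ , y≡a))         = contradiction y≡a y≢a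
        only y≢a y≢x (inj₁ i) (inj₂ (_ , y≡x))         = contradiction y≡x y≢x
        only y≢a y≢x (inj₂ z) (inj₁ (inj₁ (y≡a , _)))  = contradiction y≡a y≢a
        only y≢a y≢x (inj₂ z) (inj₁ (inj₂ (y≡x , _)))  = contradiction y≡x y≢x
        only y≢a y≢x (inj₂ z) (inj₂ (inj₁ (refl , _))) = inj₁ refl
        only y≢a y≢x (inj₂ z) (inj₂ (inj₂ (refl , _))) = inj₂ refl

        two : ∀ p {q r} → (∀ p′ → Edge g p p′ → p′ ≡ q ⊎ p′ ≡ r) → ∣ row g p ∣ ≤ 2 + d
        two p {q} {r} nbrs = ℕ.≤-trans
          (∣pair∣≤2 (row g p) (node q) (node r)
            (λ {w} w∈ → Sum.map node-place node-place (nbrs (place w) (∈-tabulate⁻ (edge? g p ∘ place) w∈))))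
          (ℕ.m≤m+n 2 d)

        universe-size : ∀ y → Dec (y ≡ a) → Dec (y ≡ x) → ∣ row g (inj₂ y) ∣ ≤ 2 + d
        universe-size y (yes refl) _          = ℕ.≤-trans (ℕ.≤-reflexive (cong ∣_∣ (row-a g))) (ℕ.≤-trans (∣star∣≤ zero S) (s≤s ∣S∣≤))
        universe-size y (no _)     (yes refl) = ℕ.≤-trans (ℕ.≤-reflexive (cong ∣_∣ (row-x g))) (ℕ.≤-trans (∣star∣≤ (top ℓ) R) (s≤s ∣R∣≤))
        universe-size y (no y≢a)   (no y≢x)   = two (inj₂ y) (only y≢a y≢x)

        row-size : ∀ p → ∣ row g p ∣ ≤ 2 + d
        row-size (inj₁ i) = two (inj₁ i) (edge-core⁻ i)
        row-size (inj₂ y) = universe-size y (y ≟ a) (y ≟ x)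

      -- The path a, core, x has 3 + ℓ nodes, and x ∈ `S` supplies the edge from its last node back
      -- to its first.
      closed-onCycle : x ∈ S → ∀ i → OnCycle (network g) (3 + ℓ) (node (inj₁ i))
      closed-onCycle x∈S i = c , cyc , suc (inject₁ i) , cong node (trans (cong (at ∘ suc) (toℕ-inject₁ i)) (at-core i))
        where
        c : Fin (3 + ℓ) → Node
        c j = node (at (toℕ j))

        c-edge : ∀ i j → Edge g (at (toℕ i)) (at (toℕ j)) → Adjacent (network g) (c i) (c j)
        c-edge i j = adjacent⁺ g {c i} {c j} ∘ subst₂ (Edge g) (sym (place-node _)) (sym (place-node _))

        cyc : IsCycle (network g) (3 + ℓ) c
        cyc = record
          { 3≤length = s≤s (s≤s (s≤s z≤n))
          ; distinct = λ {i} {j} eq → toℕ-injective (at-injective a≢x (ℕ.s≤s⁻¹ (toℕ<n i)) (ℕ.s≤s⁻¹ (toℕ<n j))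
              (trans (sym (place-node _)) (trans (cong place eq) (place-node _))))
          ; step     = λ i j 1+i≡j → c-edge i j (subst (Edge g (at (toℕ i)) ∘ at) 1+i≡j
              (at-edge (toℕ i) (ℕ.s≤s⁻¹ (ℕ.≤-trans (ℕ.≤-reflexive 1+i≡j) (ℕ.s≤s⁻¹ (toℕ<n j))))))
          ; close    = λ i j 1+i≡k j≡0 → c-edge i j (subst₂ (Edge g)
              (sym (trans (cong at (ℕ.suc-injective 1+i≡k)) at-end)) (cong at (sym j≡0))
              (inj₂ (inj₁ (refl , x∈S))))
          }

      -- Core nodes have degree 2, so a cycle through one of them contains the
      -- whole path from a to x. A cycle of length 3 + ℓ has no room for the
      -- second neighbour of a on it.
      open-¬onCycle : x ∉ S → ∀ i → ¬ OnCycle (network g) (3 + ℓ) (node (inj₁ i))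
      open-¬onCycle x∉S i (c , cyc , i₀ , ci₀≡) = ℕ.1+n≰n (injective⇒≤ h-injective)
        where
        On : Place → Set
        On p = ∃[ k ] place (c k) ≡ p

        two-neighbours : ∀ {p} → On p → ∃₂ λ q r → q ≢ r × (On q × Edge g p q) × (On r × Edge g p r)
        two-neighbours (k , refl) with q , r , q≢r , kq , kr ← cycle-neighbours {G = network g} cyc k =
          place (c q) , place (c r) , q≢r ∘ IsCycle.distinct cyc ∘ place-injective ,
          ((q , refl) , adjacent⁻ g {c k} kq) , ((r , refl) , adjacent⁻ g {c k} kr)

        -- Two distinct neighbours on the cycle, both among y and z, must be y and z.
        both : ∀ {p y z} → (∀ q → Edge g p q → q ≡ y ⊎ q ≡ z) → On p → On y × On z
        both nbrs on with q , r , q≢r , (onq , eq) , (onr , er) ← two-neighbours on | nbrs q eq | nbrs r er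
        ... | inj₁ refl | inj₁ refl = contradiction refl q≢r
        ... | inj₁ refl | inj₂ refl = onq , onr
        ... | inj₂ refl | inj₁ refl = onr , onq
        ... | inj₂ refl | inj₂ refl = contradiction refl q≢r

        step : ∀ j → j < suc ℓ → On (at (suc j)) → On (at j) × On (at (2 + j))
        step j j<1+ℓ on with i , refl , at≡ ← at-inner j<1+ℓ = both (edge-core⁻ i) (subst On at≡ on)

        path : ∀ j → j ≤ suc ℓ → On (at j) × On (at (suc j))
        path = spread (On ∘ at) (suc ℓ) step (toℕ i) (toℕ<n i)
          (i₀ , trans (cong place ci₀≡) (trans (place-node _) (sym (at-core i))))

        onPath : ∀ j → j ≤ 2 + ℓ → On (at j)
        onPath zero    _        = proj₁ (path 0 z≤n)
        onPath (suc j) (s≤s j≤) = proj₂ (path j j≤)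

        -- Only one neighbour of a lies in the core, so one of its two cycle neighbours is in `S`.
        -- It is neither a nor x, hence off the path.
        second : ∃[ y ] y ∈ S × On (inj₂ y)
        second with two-neighbours (onPath 0 z≤n)
        ... | q , r , q≢r , (onq , eq) , (onr , er) = go q r q≢r onq onr (edge-a⁻ g q eq) (edge-a⁻ g r er)
          where
          go : ∀ q r → q ≢ r → On q → On r → Near zero S q → Near zero S r → ∃[ y ] y ∈ S × On (inj₂ y)
          go (inj₂ y) _        _   onq _   y∈S  _    = y , y∈S , onq
          go (inj₁ _) (inj₂ y) _   _   onr _    y∈S  = y , y∈S , onr
          go (inj₁ _) (inj₁ _) q≢r _   _   refl refl = contradiction refl q≢r

        s    = proj₁ second
        s∈S  = proj₁ (proj₂ second)
        on-s = proj₂ (proj₂ second)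

        s-off : ∀ j → at j ≢ inj₂ s
        s-off = at-universe (λ s≡a → a∉S (subst (_∈ S) s≡a s∈S)) (λ s≡x → x∉S (subst (_∈ S) s≡x s∈S))

        on : ∀ (j : Fin (3 + ℓ)) → On (at (toℕ j))
        on j = onPath (toℕ j) (ℕ.s≤s⁻¹ (toℕ<n j))

        -- Pigeonhole: `s` and the 3 + ℓ path nodes would need 4 + ℓ distinct positions on the
        -- cycle.
        h : Fin (4 + ℓ) → Fin (3 + ℓ)
        h zero    = proj₁ on-s
        h (suc j) = proj₁ (on j)

        h-place : ∀ {p q} (onp : On p) (onq : On q) → proj₁ onp ≡ proj₁ onq → p ≡ q
        h-place (_ , refl) (_ , refl) refl = refl

        h-injective : Injective _≡_ _≡_ h
        h-injective {zero}  {zero}  _  = refl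
        h-injective {zero}  {suc j} eq = contradiction (h-place (on j) on-s (sym eq)) (s-off (toℕ j))
        h-injective {suc i} {zero}  eq = contradiction (h-place (on i) on-s eq) (s-off (toℕ i))
        h-injective {suc i} {suc j} eq = cong suc (toℕ-injective
          (at-injective a≢x (ℕ.s≤s⁻¹ (toℕ<n i)) (ℕ.s≤s⁻¹ (toℕ<n j)) (h-place (on i) (on j) eq)))

-- The fooling argument

module Fooling {ℓ m N B d : ℕ} (A : Algorithm N B (suc ⌊ ℓ /2⌋)) (id : Fin (suc ℓ + m) → Fin N) where
  open Gadgets ℓ m
  open Algorithm A
  open Indistinguishability A id

  τ : ℕ
  τ = ⌊ ℓ /2⌋

  -- The centre is at distance τ = T - 1 from the first end of the core; this puts the last end at
  -- least as far away.
  2τ≤ℓ : τ + τ ≤ ℓ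
  2τ≤ℓ = ℕ.≤-trans (ℕ.+-monoʳ-≤ τ (ℕ.⌊n/2⌋≤⌈n/2⌉ ℓ)) (ℕ.≤-reflexive (ℕ.⌊n/2⌋+⌈n/2⌉≡n ℓ))

  centre : Fin (suc ℓ)
  centre = fromℕ< (s≤s (ℕ.⌊n/2⌋≤n ℓ))

  sendFrom : Place → Place → Subset (suc ℓ + m) → Message B
  sendFrom p q s = send (knowledgeOf (node p) s) [] (id (node q))

  message : Fin (suc ℓ) → Fin m → Subset m → Message B
  message t y S = sendFrom (inj₂ y) (inj₁ t) (star t S)

  -- Distance from the centre along the core; every universe node gets T = 1 + τ, a lower bound for
  -- its distance.
  level : Place → ℕ
  level (inj₁ i) = ∣ toℕ i - τ ∣
  level (inj₂ _) = suc τ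

  core-step : ∀ {i j} → suc i ≡ j ⊎ suc j ≡ i → ∣ j - τ ∣ ≤ suc ∣ i - τ ∣
  core-step {i} {j} i~j = ℕ.≤-trans (ℕ.∣-∣-triangle j i τ) (ℕ.+-monoˡ-≤ ∣ i - τ ∣ (ℕ.≤-reflexive (distance i~j)))
    where
    distance : suc i ≡ j ⊎ suc j ≡ i → ∣ j - i ∣ ≡ 1
    distance (inj₁ refl) = trans (ℕ.∣-∣-comm (suc i) i) (trans (cong (∣ i -_∣) (ℕ.+-comm 1 i)) (ℕ.∣m-m+n∣≡n i 1))
    distance (inj₂ refl) = trans (cong (∣ j -_∣) (ℕ.+-comm 1 j)) (ℕ.∣m-m+n∣≡n j 1)

  module _ {a x} (g g′ : Gadget a x)
           (same-a : message zero a (Gadget.S g) ≡ message zero a (Gadget.S g′))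
           (same-x : message (top ℓ) x (Gadget.R g) ≡ message (top ℓ) x (Gadget.R g′))
           where

    row-core : ∀ i → row g (inj₁ i) ≡ row g′ (inj₁ i)
    row-core i = tabulate-cong (core ∘ place)
      where
      core : ∀ q → does (edge? g (inj₁ i) q) ≡ does (edge? g′ (inj₁ i) q)
      core (inj₁ _) = refl
      core (inj₂ _) = refl

    row-inner : ∀ p → level p < suc τ → row g p ≡ row g′ p
    row-inner (inj₁ i) _   = row-core i
    row-inner (inj₂ y) τ<τ = contradiction τ<τ (ℕ.<-irrefl refl)

    level-edge : ∀ p q → level p < suc τ → Edge g p q → level q ≤ suc (level p)
    level-edge (inj₁ i) (inj₁ j) _ i~j = core-step i~j
    level-edge (inj₁ i) (inj₂ y) _ (inj₁ (refl , _)) = ℕ.≤-refl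
    level-edge (inj₁ i) (inj₂ y) _ (inj₂ (refl , _)) = s≤s (ℕ.≤-trans (ℕ.m+n≤o⇒m≤o∸n τ 2τ≤ℓ)
      (subst (λ t → ℓ ∸ τ ≤ ∣ t - τ ∣) (sym (toℕ-fromℕ ℓ)) (ℕ.m∸n≤∣m-n∣ ℓ τ)))
    level-edge (inj₂ y) q τ<τ _ = contradiction τ<τ (ℕ.<-irrefl refl)

    -- A node below level T is in the core. Its neighbours are core nodes, whose rows agree in both
    -- gadgets, or a and x, whose first messages agree by assumption.
    first-message : ∀ p q → level p < suc τ → Edge g p q →
                    sendFrom q p (row g q) ≡ sendFrom q p (row g′ q)
    first-message (inj₁ i) (inj₁ j) _ _ = cong (sendFrom (inj₁ j) (inj₁ i)) (row-core j)
    first-message (inj₁ i) (inj₂ y) _ (inj₁ (refl , refl)) = begin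
      sendFrom (inj₂ a) (inj₁ zero) (row g (inj₂ a))   ≡⟨ cong (sendFrom (inj₂ a) (inj₁ zero)) (row-a g) ⟩
      message zero a (Gadget.S g)                      ≡⟨ same-a ⟩
      message zero a (Gadget.S g′)                     ≡⟨ cong (sendFrom (inj₂ a) (inj₁ zero)) (row-a g′) ⟨
      sendFrom (inj₂ a) (inj₁ zero) (row g′ (inj₂ a))  ∎
      where open ≡-Reasoning
    first-message (inj₁ i) (inj₂ y) _ (inj₂ (refl , refl)) = begin
      sendFrom (inj₂ x) (inj₁ (top ℓ)) (row g (inj₂ x))   ≡⟨ cong (sendFrom (inj₂ x) (inj₁ (top ℓ))) (row-x g) ⟩
      message (top ℓ) x (Gadget.R g)                      ≡⟨ same-x ⟩
      message (top ℓ) x (Gadget.R g′)                     ≡⟨ cong (sendFrom (inj₂ x) (inj₁ (top ℓ))) (row-x g′) ⟨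
      sendFrom (inj₂ x) (inj₁ (top ℓ)) (row g′ (inj₂ x))  ∎
      where open ≡-Reasoning
    first-message (inj₂ y) q τ<τ _ = contradiction τ<τ (ℕ.<-irrefl refl)

    same-result : result (network g) (node (inj₁ centre)) ≡ result (network g′) (node (inj₁ centre))
    same-result = result-agree (network g) (network g′) (level ∘ place)
      (λ {u} u<T → row-inner (place u) u<T)
      (λ {u} {w} u<T w∈ → level-edge (place u) (place w) u<T (adjacent⁻ g {u} w∈))
      (λ {u} {w} u<T w∈ → subst₂
        (λ u′ w′ → send (knowledgeOf w′ (row g (place w))) [] (id u′) ≡ send (knowledgeOf w′ (row g′ (place w))) [] (id u′))
        (sym (node-place {u} refl)) (sym (node-place {w} refl))
        (first-message (place u) (place w) u<T (adjacent⁻ g {u} w∈)))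
      (trans (cong level (place-node (inj₁ centre))) (trans (cong (λ t → ∣ t - τ ∣) (toℕ-fromℕ< (s≤s (ℕ.⌊n/2⌋≤n ℓ)))) (ℕ.∣n-n∣≡0 τ)))
      (s≤s z≤n)

  -- The size bound is Δ - 1 because y also has the core neighbour `t`; y is kept out of its own
  -- lists to avoid loops.
  Collision : Fin (suc ℓ) → Fin m → Fin m → Set
  Collision t y z = ∃₂ λ S S′ → (∣ S ∣ ≤ suc d × ∣ S′ ∣ ≤ suc d) × (y ∉ S × y ∉ S′) × (z ∈ S × z ∉ S′) ×
                    message t y S ≡ message t y S′

  collision? : ∀ t y z → Dec (Collision t y z)
  collision? t y z = anySubset? λ S → anySubset? λ S′ →
    (∣ S ∣ ℕ.≤? suc d ×-dec ∣ S′ ∣ ℕ.≤? suc d) ×-dec (¬? (y ∈? S) ×-dec ¬? (y ∈? S′)) ×-dec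
    (z ∈? S ×-dec ¬? (z ∈? S′)) ×-dec ≡-dec Bool._≟_ (message t y S) (message t y S′)

  revealed? : ∀ t y → Decidable λ z → z ≢ y × ¬ Collision t y z
  revealed? t y z = ¬? (z ≟ y) ×-dec ¬? (collision? t y z)

  Revealed : Fin (suc ℓ) → Fin m → Subset m
  Revealed t y = tabulate (does ∘ revealed? t y)

  -- Otherwise `S` and `S′` would form a collision at z; lists inside `Revealed t y` avoid y, as a
  -- collision demands.
  revealed-determines : ∀ t y → Determines (message t y) (suc d) (Revealed t y)
  revealed-determines t y {z} {S} {S′} ∣S∣≤ ∣S′∣≤ S⊆ S′⊆ z∈ eq z∈S = decidable-stable (z ∈? S′) λ z∉S′ →
    proj₂ (∈-tabulate⁻ (revealed? t y) z∈)
      (S , S′ , (∣S∣≤ , ∣S′∣≤) , (y∉ S⊆ , y∉ S′⊆) , (z∈S , z∉S′) , eq)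
    where
    y∉ : ∀ {S} → S ⊆ Revealed t y → y ∉ S
    y∉ S⊆ y∈S = proj₁ (∈-tabulate⁻ (revealed? t y) (S⊆ y∈S)) refl

  module _ (id-injective : Injective _≡_ _≡_ id) (solves : SolvesCycleMembership (suc ℓ + m) (2 + d) (3 + ℓ) A) where

    -- Pairing the lists that contain the edge between a and x, and those that lack it, gives two
    -- gadgets. The centre lies on a k-cycle in the first only, yet outputs the same in both.
    no-double-collision : ∀ {a x} → a ≢ x → Collision zero a x → ¬ Collision (top ℓ) x a
    no-double-collision {a} {x} a≢x (S , S′ , (S≤ , S′≤) , (a∉S , a∉S′) , (x∈S , x∉S′) , same-a)
                                    (R , R′ , (R≤ , R′≤) , (x∉R , x∉R′) , (a∈R , a∉R′) , same-x) =
      open-¬onCycle g′ x∉S′ centre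
        (Equivalence.to (solves (network g′) (degree≤ g′ S′≤ R′≤) id id-injective v)
          (trans (sym (same-result g g′ same-a same-x))
            (Equivalence.from (solves (network g) (degree≤ g S≤ R≤) id id-injective v)
              (closed-onCycle g x∈S centre))))
      where
      v = node (inj₁ centre)

      g g′ : Gadget a x
      g  = record { S = S ; R = R ; a≢x = a≢x ; a∉S = a∉S ; x∉R = x∉R
                  ; x∈S⇒a∈R = λ _ → a∈R ; a∈R⇒x∈S = λ _ → x∈S }
      g′ = record { S = S′ ; R = R′ ; a≢x = a≢x ; a∉S = a∉S′ ; x∉R = x∉R′
                  ; x∈S⇒a∈R = λ x∈S′ → contradiction x∈S′ x∉S′ ; a∈R⇒x∈S = λ a∈R′ → contradiction a∈R′ a∉R′ }

    revealed-cover : ∀ {a x} → a ≢ x → x ∈ Revealed zero a ⊎ a ∈ Revealed (top ℓ) x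
    revealed-cover {a} {x} a≢x with collision? zero a x
    ... | no ¬coll = inj₁ (∈-tabulate⁺ (revealed? zero a) (a≢x ∘ sym , ¬coll))
    ... | yes coll = inj₂ (∈-tabulate⁺ (revealed? (top ℓ) x) (a≢x , no-double-collision a≢x coll))

    message-count : .{{_ : NonZero m}} →
                    ∀ {d′ q} → d′ ≤ suc d → d′ * q ≤ ⌊ m /2⌋ → suc q ℕ.^ d′ ≤ 2 ℕ.^ B
    message-count d′≤ d′q≤ with large-row (Revealed zero) (Revealed (top ℓ)) revealed-cover
    ... | inj₁ (a , large) = blocks≤2^B (message zero a) (revealed-determines zero a) d′≤ (ℕ.≤-trans d′q≤ large)
    ... | inj₂ (x , large) = blocks≤2^B (message (top ℓ) x) (revealed-determines (top ℓ) x) d′≤ (ℕ.≤-trans d′q≤ large)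

-- Assembly of the logarithmic bound

log-bound : ∀ ℓ m d {n} → n ≡ suc ℓ + m → 2 * (3 + ℓ) ≤ n → ∀ {N B} → n ≤ N →
            (A : Algorithm N B (suc ⌊ ℓ /2⌋)) → SolvesCycleMembership n (2 + d) (3 + ℓ) A →
            ½ ·log₂ logArgument n (2 + d) (s≤s (s≤s z≤n)) ≤ B
log-bound ℓ m d refl 2k≤n {N} {B} n≤N A solves =
  let size            = 5+ℓ≤m ℓ m 2k≤n
      -- The IDs are the node indices, embedded by n ≤ N.
      id-injective    = λ {u} {w} → inject≤-injective n≤N n≤N u w
      m≢0             = ℕ.>-nonZero (ℕ.≤-trans (s≤s z≤n) size)
      b , n≤ , b^d≤   = block-arithmetic (suc ℓ + m) ⌊ m /2⌋ (suc d) B (n≤4⌊m/2⌋ ℓ m size)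
                          (Fooling.message-count A (λ u → inject≤ u n≤N) id-injective solves {{m≢0}})
      2≤n             = ℕ.+-mono-≤ (s≤s z≤n) (ℕ.≤-trans (s≤s z≤n) size)
  in ½·log₂-≤ (suc ℓ + m) d B b (ℕ.≤-trans (ℕ.m∸n≤m _ 2) n≤) b^d≤ 2≤n

theorem6 : (ε C : ℝ) → 0ℚ <ℝ ε → ε ℝ< 1ℚ → 0ℚ <ℝ C →
    Σ ℚ λ c → 0ℚ ℚ.< c × Σ ℕ λ n₀ →
    (n Δ k : ℕ) → n₀ ≤ n → (2≤Δ : 2 ≤ Δ) → Δ ≤ n ∸ 1 →
    4 ≤ k → PowerBound k C n ε →
    (N B : ℕ) → n ≤ N → 1 ≤ B →
    (A : Algorithm N B ⌊ k ∸ 1 /2⌋) → SolvesCycleMembership n Δ k A →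
    c ·log₂ logArgument n Δ 2≤Δ ≤ B
-- The constant ½ comes from the exponent B · 2 in `block-arithmetic`; n₀ ensures 2 k ≤ n, so the
-- universe holds more than half of the nodes.
theorem6 ε C 0<ε ε<1 _ = ½ , ℚ.positive⁻¹ ½ , proj₁ sizes , bound
  where
  sizes = PowerBound⇒2k≤n ε C 0<ε ε<1

  bound : (n Δ k : ℕ) → proj₁ sizes ≤ n → (2≤Δ : 2 ≤ Δ) → Δ ≤ n ∸ 1 → 4 ≤ k → PowerBound k C n ε →
          (N B : ℕ) → n ≤ N → 1 ≤ B → (A : Algorithm N B ⌊ k ∸ 1 /2⌋) →
          SolvesCycleMembership n Δ k A → ½ ·log₂ logArgument n Δ 2≤Δ ≤ B
  bound n (suc (suc d)) (suc (suc (suc ℓ))) n₀≤n (s≤s (s≤s z≤n)) _ (s≤s (s≤s (s≤s _))) power N B n≤N _ =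
    -- With k = 3 + ℓ, the round number reduces to 1 + ⌊ℓ/2⌋, and the universe has n - (1 + ℓ)
    -- nodes.
    log-bound ℓ (n ∸ suc ℓ) d (sym (ℕ.m+[n∸m]≡n 1+ℓ≤n)) 2k≤n n≤N
    where
    2k≤n : 2 * (3 + ℓ) ≤ n
    2k≤n = proj₂ sizes (3 + ℓ) n n₀≤n power

    1+ℓ≤n : suc ℓ ≤ n
    1+ℓ≤n = ℕ.≤-trans (ℕ.≤-trans (ℕ.m≤n+m (suc ℓ) 2) (ℕ.m≤m+n (3 + ℓ) _)) 2k≤n
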